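{- Let $G=(V,E)$ be a finite, connected, simple, walk-regular graph with $|V|\ge 3$, with unit resistance across each edge. Let $(a,b)\in E$ be an edge which is not a cut-edge (that is, deleting it leaves the graph connected), and let $G'$ be the graph formed from $G$ by deleting the edge $(a,b)$. Let $R_{ab}$ denote the effective resistance between $a$ and $b$ in $G$, let $E_aT_b$ denote the expected hitting time of $b$ for simple random walk on $G$ started at $a$, and let $E_aT_b^{G'}$ denote the expected hitting time of $b$ for simple random walk on $G'$ started at $a$. Then, on deleting the edge $(a,b)$, the expected hitting time increases from $$E_aT_b=|E|\,R_{ab}$$ to $$E_aT_b^{G'}=\frac{(|E|-1)R_{ab}}{1-R_{ab}}=\frac{E_aT_b-R_{ab}}{1-R_{ab}}.$$
   Context: Simple random walk on a graph is the Markov chain $X_j$ on the vertex set with $P(X_{j+1}=z\mid X_j=y)=1/\deg(y)$ if $y$ and $z$ are adjacent, and $0$ otherwise. The hitting time of a vertex $b$ is $T_b=\inf\{j\ge 0: X_j=b\}$, and $E_a$ denotes expectation for the walk started at $X_0=a$. The graph is viewed as an electric network in which every edge is a resistor of unit resistance. The effective resistance $R_{ab}$ between distinct vertices $a,b$ is the voltage difference between $a$ and $b$ when a unit current enters the network at $a$ and leaves at $b$. A graph is walk-regular if, for every $k\ge 2$, the number of closed walks of length $k$ (repeated vertices and edges allowed) starting and ending at a vertex $x$ is the same for every choice of the vertex $x$. -}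

module Defs where

open import Data.Fin using (Fin) renaming (_<_ to _<ᶠ_)
open import Data.Fin.Properties using (_≟_) renaming (_<?_ to _<ᶠ?_)
open import Data.Integer using (+_)
open import Data.List using (List; []; _∷_; allFin; cartesianProduct; cartesianProductWith; filter; foldr; length; map; upTo)
open import Data.Nat using (ℕ; zero; suc) renaming (_≤_ to _≤ⁿ_)
open import Data.Product using (_×_; _,_; ∃-syntax)
open import Data.Rational using (ℚ; 0ℚ; 1ℚ; _+_; _*_; _-_; _/_; _<_; ∣_∣)
open import Data.Sum using (_⊎_; inj₁; inj₂)
open import Data.Unit using (⊤; tt)
open import Data.Vec using (Vec; init; last) renaming ([] to []ᵛ; _∷_ to _∷ᵛ_)
open import Data.Vec.Relation.Unary.All using (All; all?)
open import Function using (_∘_)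
open import Level using (0ℓ)
open import Relation.Binary.Construct.Closure.ReflexiveTransitive using (Star)
open import Relation.Binary.Core using (Rel)
open import Relation.Binary.Definitions using (Decidable; Irreflexive; Symmetric)
open import Relation.Binary.PropositionalEquality using (_≡_; _≢_)
open import Relation.Nullary using (Dec; yes; no; ¬_; ¬?; _×-dec_; _⊎-dec_)

fromℕ : ℕ → ℚ
fromℕ m = + m / 1

sumOver : ∀ {A : Set} → List A → (A → ℚ) → ℚ
sumOver xs f = foldr _+_ 0ℚ (map f xs)

syntax sumOver xs (λ x → e) = ∑[ x ← xs ] e

infix 4 _⟶_

_⟶_ : (ℕ → ℚ) → ℚ → Set
s ⟶ l = ∀ ε → 0ℚ < ε → ∃[ N ] (∀ m → N ≤ⁿ m → ∣ s m - l ∣ < ε)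

HasSum : (ℕ → ℚ) → ℚ → Set
HasSum t l = (λ N → ∑[ j ← upTo N ] t j) ⟶ l

record Graph (n : ℕ) : Set₁ where
  field
    Adj    : Rel (Fin n) 0ℓ
    adj?   : Decidable Adj
    sym    : Symmetric Adj
    irrefl : Irreflexive _≡_ Adj

open Graph public using (Adj)

module _ {n : ℕ} (G : Graph n) where
  open Graph G using (adj?)

  Connected : Set
  Connected = ∀ x y → Star (Adj G) x y

  neighbours : Fin n → List (Fin n)
  neighbours x = filter (adj? x) (allFin n)

  deg : Fin n → ℕ
  deg x = length (neighbours x)

  -- Each edge {x , y} is counted once, through its representative with x < y.
  edgeCount : ℕ
  edgeCount = length (filter (λ (x , y) → (x <ᶠ? y) ×-dec adj? x y)
                             (cartesianProduct (allFin n) (allFin n)))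

SameEdge : ∀ {n} → (a b x y : Fin n) → Set
SameEdge a b x y = (x ≡ a × y ≡ b) ⊎ (x ≡ b × y ≡ a)

sameEdge? : ∀ {n} (a b x y : Fin n) → Dec (SameEdge a b x y)
sameEdge? a b x y = (x ≟ a ×-dec y ≟ b) ⊎-dec (x ≟ b ×-dec y ≟ a)

deleteEdge : ∀ {n} → Graph n → (a b : Fin n) → Graph n
deleteEdge G a b = record
  { Adj    = λ x y → Adj G x y × ¬ SameEdge a b x y
  ; adj?   = λ x y → Graph.adj? G x y ×-dec ¬? (sameEdge? a b x y)
  ; sym    = λ (p , ¬e) → Graph.sym G p , ¬e ∘ flipEdge
  ; irrefl = λ x≡y (p , _) → Graph.irrefl G x≡y p
  }
  where
  flipEdge : ∀ {x y} → SameEdge a b y x → SameEdge a b x y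
  flipEdge (inj₁ (p , q)) = inj₂ (q , p)
  flipEdge (inj₂ (p , q)) = inj₁ (q , p)

-- A trajectory x₀, x₁, …, x_k is given by its starting vertex x₀ together
-- with the vector of the k later positions.
allVecs : ∀ {n} k → List (Vec (Fin n) k)
allVecs zero    = []ᵛ ∷ []
allVecs (suc k) = cartesianProductWith _∷ᵛ_ (allFin _) (allVecs k)

module _ {n : ℕ} (G : Graph n) where
  open Graph G using (adj?)

  IsWalk : ∀ {k} → Fin n → Vec (Fin n) k → Set
  IsWalk x []ᵛ       = ⊤
  IsWalk x (y ∷ᵛ ys) = Adj G x y × IsWalk y ys

  isWalk? : ∀ {k} x (ys : Vec (Fin n) k) → Dec (IsWalk x ys)
  isWalk? x []ᵛ       = yes tt
  isWalk? x (y ∷ᵛ ys) = adj? x y ×-dec isWalk? y ys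

  closedWalkCount : ℕ → Fin n → ℕ
  closedWalkCount k x =
    length (filter (λ ys → isWalk? x ys ×-dec last (x ∷ᵛ ys) ≟ x) (allVecs k))

  WalkRegular : Set
  WalkRegular = ∀ k → 2 ≤ⁿ k → ∀ x y → closedWalkCount k x ≡ closedWalkCount k y

-- The value at 0 is never used: a vertex with a neighbour has positive degree.
reciprocal : ℕ → ℚ
reciprocal zero    = 0ℚ
reciprocal (suc m) = + 1 / suc m

FirstHitAtEnd : ∀ {n k} → (b x : Fin n) → Vec (Fin n) k → Set
FirstHitAtEnd b x ys = last (x ∷ᵛ ys) ≡ b × All (_≢ b) (init (x ∷ᵛ ys))

firstHitAtEnd? : ∀ {n k} (b x : Fin n) (ys : Vec (Fin n) k) →
                 Dec (FirstHitAtEnd b x ys)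
firstHitAtEnd? b x ys =
  last (x ∷ᵛ ys) ≟ b ×-dec all? (λ z → ¬? (z ≟ b)) (init (x ∷ᵛ ys))

module _ {n : ℕ} (G : Graph n) where

  transition : Fin n → Fin n → ℚ
  transition y z with Graph.adj? G y z
  ... | yes _ = reciprocal (deg G y)
  ... | no  _ = 0ℚ

  trajectoryProb : ∀ {k} → Fin n → Vec (Fin n) k → ℚ
  trajectoryProb x []ᵛ       = 1ℚ
  trajectoryProb x (y ∷ᵛ ys) = transition x y * trajectoryProb y ys

  -- P_a(T_b = j)
  hittingProb : (a b : Fin n) → ℕ → ℚ
  hittingProb a b j =
    ∑[ ys ← filter (firstHitAtEnd? b a) (allVecs j) ] trajectoryProb a ys

  -- T_b may take the value ∞, so its expectation is the finite number h exactly
  -- when T_b is almost surely finite and ∑ j P_a(T_b = j) = h.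
  IsExpectedHittingTime : (a b : Fin n) → ℚ → Set
  IsExpectedHittingTime a b h =
      HasSum (hittingProb a b) 1ℚ
    × HasSum (λ j → fromℕ j * hittingProb a b j) h

indicator : ∀ {n} → Fin n → Fin n → ℚ
indicator a x with x ≟ a
... | yes _ = 1ℚ
... | no  _ = 0ℚ

module _ {n : ℕ} (G : Graph n) where

  -- By Ohm's law the current from x to a neighbour y is v x - v y; Kirchhoff's
  -- law equates the total current out of x with the external current into x.
  IsUnitCurrentVoltage : (a b : Fin n) → (Fin n → ℚ) → Set
  IsUnitCurrentVoltage a b v =
    ∀ x → (∑[ y ← neighbours G x ] (v x - v y)) ≡ indicator a x - indicator b x

  -- Voltages are determined only up to an additive constant, so the voltage
  -- difference is required to be the same for all of them.
  IsEffectiveResistance : (a b : Fin n) → ℚ → Set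
  IsEffectiveResistance a b R =
      (∃[ v ] IsUnitCurrentVoltage a b v)
    × (∀ v → IsUnitCurrentVoltage a b v → v a - v b ≡ R)

{-# OPTIONS --safe #-}

-- Let L be the Laplacian of G and u = e_a − e_b.  Walk-regularity makes the diagonals of all
-- powers of the adjacency matrix constant, so e_a + e_b is orthogonal to every Lᵏ u, and the
-- solution v of L v = u with mean zero, which lies in the Krylov space of u, satisfies
-- v(a) + v(b) = 0.  The hitting times f of b satisfy L f = deg − (Σ deg) e_b and f(b) = 0, so
-- self-adjointness of L gives f(a) = ⟨L v , f⟩ = ⟨v , deg⟩ − (Σ deg) v(b).  As G is regular,
-- ⟨v , deg⟩ = 0 and f(a) = |E| R.  Deleting the edge changes L by − u uᵀ, so v / (1 − R) is a
-- unit voltage of G′, and deg changes by − e_a − e_b, so v is still orthogonal to the degrees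
-- and the same computation applies to G′.  That the hitting time increases amounts to f(a) > 1.
module Submission where

open import Defs
open import Algebra.Bundles using (CommutativeRing)
open import Data.Bool using (true; false; if_then_else_)
open import Data.Fin using (Fin; zero; suc; punchIn; toℕ)
import Data.Fin.Properties as Fin
import Data.Integer as ℤ
import Data.Integer.Properties as ℤ
open import Data.List using (List; []; _∷_; _++_; allFin; cartesianProductWith; filter; length; map; tabulate; upTo)
open import Data.List.Properties using (upTo-∷ʳ)
open import Data.Nat as ℕ using (ℕ; zero; suc) renaming (_≤_ to _≤ⁿ_)
import Data.Nat.Properties as ℕ
open import Data.Product using (_×_; _,_; Σ-syntax; ∃-syntax; proj₁; proj₂)
open import Data.Rational
open import Data.Rational.Properties
import Data.Rational.Unnormalised as ℚᵘ
import Data.Rational.Unnormalised.Properties as ℚᵘ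
open import Data.Sum using (inj₁; inj₂)
open import Data.Vec using (Vec; last) renaming ([] to []ᵛ; _∷_ to _∷ᵛ_)
open import Data.Vec.Functional using (insertAt)
open import Data.Vec.Functional.Properties using (insertAt-lookup; insertAt-punchIn)
import Data.Vec.Relation.Unary.All as All
open import Function using (_∘_; const)
open import Level using (0ℓ)
open import Relation.Binary.Construct.Closure.ReflexiveTransitive as Star using (_◅_; fold)
open import Relation.Binary.Definitions using (tri<; tri≈; tri>)
open import Relation.Binary.PropositionalEquality
open import Relation.Nullary using (Dec; does; yes; no; ¬_; ¬?; contradiction)
open import Relation.Nullary.Decidable using (dec⇒maybe; decidable-stable; _×-dec_; _⊎-dec_; dec-true; dec-false)
open import Relation.Unary using (Decidable)
open import Tactic.RingSolver using (solve-∀)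
open import Tactic.RingSolver.Core.AlmostCommutativeRing using (AlmostCommutativeRing; fromCommutativeRing)

open import Algebra.Properties.Semiring.Sum (CommutativeRing.semiring +-*-commutativeRing)
  using (sum; sum-cong-≗; ∑-distrib-+; ∑-comm; sum-remove; sum-replicate-zero; *-distribˡ-sum)

-- All quantities live in ℚ, so neither eigenvectors nor completeness is at hand. The preimage of u
-- under the Laplacian comes from a linear dependence among u, L u, ..., Lⁿ u, which keeps it inside
-- a given L-stable subspace that contains u and on which L is injective; this is how orthogonality
-- relations pass from u to the voltage. The limit of the hitting-time series has to be named before
-- convergence is proved: it is the solution f of the first-step equations. With s_N the probability
-- that b has not been hit by time N, the remainder of Σ s_k against f is the killed transition
-- operator iterated on f, while s_N is the same iteration on the indicator of the complement of b.
-- Since f vanishes at b, positivity bounds the remainder by C s_N, and this comparison alone gives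
-- decay fast enough for both series, with no geometric rate. Invertibility of 1 - R comes from
-- connectedness of G′: if R were 1, v would be harmonic on G′, hence constant, and R would be 0.

ring : AlmostCommutativeRing 0ℓ 0ℓ
ring = fromCommutativeRing +-*-commutativeRing (λ x → dec⇒maybe (0ℚ ≟ x))

-- Order on ℚ

0≤q-p⇒p≤q : ∀ {p q} → 0ℚ ≤ q - p → p ≤ q
0≤q-p⇒p≤q {p} {q} 0≤q-p = subst₂ _≤_ (+-identityˡ p) (eq q p) (+-monoˡ-≤ p 0≤q-p)
  where
  eq : ∀ q p → q - p + p ≡ q
  eq = solve-∀ ring

p<q⇒0<q-p : ∀ {p q} → p < q → 0ℚ < q - p
p<q⇒0<q-p {p} {q} p<q = subst (_< q - p) (+-inverseʳ p) (+-monoˡ-< (- p) p<q)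

0<q-p⇒p<q : ∀ {p q} → 0ℚ < q - p → p < q
0<q-p⇒p<q {p} {q} 0<q-p = subst₂ _<_ (+-identityˡ p) (eq q p) (+-monoˡ-< p 0<q-p)
  where
  eq : ∀ q p → q - p + p ≡ q
  eq = solve-∀ ring

+-nonNeg : ∀ {p q} → 0ℚ ≤ p → 0ℚ ≤ q → 0ℚ ≤ p + q
+-nonNeg = +-mono-≤

*-nonNeg : ∀ {p q} → 0ℚ ≤ p → 0ℚ ≤ q → 0ℚ ≤ p * q
*-nonNeg {p} {q} 0≤p 0≤q =
  nonNegative⁻¹ (p * q) {{nonNeg*nonNeg⇒nonNeg p {{nonNegative 0≤p}} q {{nonNegative 0≤q}}}}

*-pos : ∀ {p q} → 0ℚ < p → 0ℚ < q → 0ℚ < p * q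
*-pos {p} {q} 0<p 0<q = positive⁻¹ (p * q) {{pos*pos⇒pos p {{positive 0<p}} q {{positive 0<q}}}}

*-monoˡ-≤ : ∀ {p q} r → 0ℚ ≤ r → p ≤ q → r * p ≤ r * q
*-monoˡ-≤ r 0≤r = *-monoˡ-≤-nonNeg r {{nonNegative 0≤r}}

*-monoʳ-≤ : ∀ {p q} r → 0ℚ ≤ r → p ≤ q → p * r ≤ q * r
*-monoʳ-≤ r 0≤r = *-monoʳ-≤-nonNeg r {{nonNegative 0≤r}}

p≤∣p∣ : ∀ p → p ≤ ∣ p ∣
p≤∣p∣ p with ≤-total 0ℚ p
... | inj₁ 0≤p = ≤-reflexive (sym (0≤p⇒∣p∣≡p 0≤p))
... | inj₂ p≤0 = ≤-trans p≤0 (0≤∣p∣ p)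

-p≤∣p∣ : ∀ p → - p ≤ ∣ p ∣
-p≤∣p∣ p = subst (- p ≤_) (∣-p∣≡∣p∣ p) (p≤∣p∣ (- p))

square-nonNeg : ∀ p → 0ℚ ≤ p * p
square-nonNeg p with ≤-total 0ℚ p
... | inj₁ 0≤p = *-nonNeg 0≤p 0≤p
... | inj₂ p≤0 = subst (0ℚ ≤_) (eq p) (*-nonNeg (neg-antimono-≤ p≤0) (neg-antimono-≤ p≤0))
  where
  eq : ∀ p → - p * - p ≡ p * p
  eq = solve-∀ ring

p-q≡0⇒p≡q : ∀ {p q} → p - q ≡ 0ℚ → p ≡ q
p-q≡0⇒p≡q {p} {q} eq = trans (trans (split p q) (cong (_+ q) eq)) (+-identityˡ q)
  where
  split : ∀ p q → p ≡ p - q + q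
  split = solve-∀ ring

*-cancelˡ-≢0 : ∀ {p q r} → r ≢ 0ℚ → r * p ≡ r * q → p ≡ q
*-cancelˡ-≢0 {p} {q} {r} r≢0 eq = begin
  p              ≡⟨ lem p ⟨
  1/ r * (r * p) ≡⟨ cong (1/ r *_) eq ⟩
  1/ r * (r * q) ≡⟨ lem q ⟩
  q              ∎
  where
  open ≡-Reasoning
  instance nz = ≢-nonZero r≢0
  lem : ∀ s → 1/ r * (r * s) ≡ s
  lem s = trans (sym (*-assoc (1/ r) r s)) (trans (cong (_* s) (*-inverseˡ r)) (*-identityˡ s))

p*q≡0⇒q≡0 : ∀ {p q} → p ≢ 0ℚ → p * q ≡ 0ℚ → q ≡ 0ℚ
p*q≡0⇒q≡0 {p} p≢0 eq = *-cancelˡ-≢0 p≢0 (trans eq (sym (*-zeroʳ p)))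

square≡0 : ∀ {p} → p * p ≡ 0ℚ → p ≡ 0ℚ
square≡0 {p} eq with p ≟ 0ℚ
... | yes p≡0 = p≡0
... | no  p≢0 = p*q≡0⇒q≡0 p≢0 eq

-- Finite sums

∑ : ∀ {n} → (Fin n → ℚ) → ℚ
∑ = sum

∑-cong : ∀ {n} {f g : Fin n → ℚ} → f ≗ g → ∑ f ≡ ∑ g
∑-cong = sum-cong-≗

∑-0 : ∀ n → ∑ {n} (λ _ → 0ℚ) ≡ 0ℚ
∑-0 = sum-replicate-zero

∑-≗0 : ∀ {n} {f : Fin n → ℚ} → (∀ i → f i ≡ 0ℚ) → ∑ f ≡ 0ℚ
∑-≗0 {n} f≗0 = trans (∑-cong f≗0) (∑-0 n)

∑-*ˡ : ∀ {n} c (f : Fin n → ℚ) → ∑ (λ i → c * f i) ≡ c * ∑ f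
∑-*ˡ c f = sym (*-distribˡ-sum c f)

∑-linear : ∀ {n} c d (f g : Fin n → ℚ) → ∑ (λ i → c * f i + d * g i) ≡ c * ∑ f + d * ∑ g
∑-linear c d f g =
  trans (∑-distrib-+ (λ i → c * f i) (λ i → d * g i)) (cong₂ _+_ (∑-*ˡ c f) (∑-*ˡ d g))

∑-distrib-- : ∀ {n} (f g : Fin n → ℚ) → ∑ (λ i → f i - g i) ≡ ∑ f - ∑ g
∑-distrib-- f g = begin
  ∑ (λ i → f i - g i)              ≡⟨ ∑-cong (λ i → unit (f i) (g i)) ⟩
  ∑ (λ i → 1ℚ * f i + - 1ℚ * g i)  ≡⟨ ∑-linear 1ℚ (- 1ℚ) f g ⟩
  1ℚ * ∑ f + - 1ℚ * ∑ g            ≡⟨ unit (∑ f) (∑ g) ⟨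
  ∑ f - ∑ g                        ∎
  where
  open ≡-Reasoning
  unit : ∀ p q → p - q ≡ 1ℚ * p + - 1ℚ * q
  unit = solve-∀ ring

∑-nonNeg : ∀ {n} {f : Fin n → ℚ} → (∀ i → 0ℚ ≤ f i) → 0ℚ ≤ ∑ f
∑-nonNeg {zero}  0≤f = ≤-refl
∑-nonNeg {suc n} 0≤f = +-nonNeg (0≤f zero) (∑-nonNeg (0≤f ∘ suc))

∑-mono : ∀ {n} {f g : Fin n → ℚ} → (∀ i → f i ≤ g i) → ∑ f ≤ ∑ g
∑-mono {zero}  f≤g = ≤-refl
∑-mono {suc n} f≤g = +-mono-≤ (f≤g zero) (∑-mono (f≤g ∘ suc))

term≤∑ : ∀ {n} {f : Fin n → ℚ} → (∀ i → 0ℚ ≤ f i) → ∀ i → f i ≤ ∑ f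
term≤∑ {suc n} {f} 0≤f zero    =
  subst (_≤ ∑ f) (+-identityʳ (f zero)) (+-monoʳ-≤ (f zero) (∑-nonNeg (0≤f ∘ suc)))
term≤∑ {suc n} {f} 0≤f (suc i) =
  subst (_≤ ∑ f) (+-identityˡ (f (suc i))) (+-mono-≤ (0≤f zero) (term≤∑ (0≤f ∘ suc) i))

∑≡0⇒≗0 : ∀ {n} {f : Fin n → ℚ} → (∀ i → 0ℚ ≤ f i) → ∑ f ≡ 0ℚ → ∀ i → f i ≡ 0ℚ
∑≡0⇒≗0 {f = f} 0≤f eq i = ≤-antisym (subst (f i ≤_) eq (term≤∑ 0≤f i)) (0≤f i)

∣∑∣≤∑∣∣ : ∀ {n} (f : Fin n → ℚ) → ∣ ∑ f ∣ ≤ ∑ (λ i → ∣ f i ∣)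
∣∑∣≤∑∣∣ {zero}  f = ≤-refl
∣∑∣≤∑∣∣ {suc n} f =
  ≤-trans (∣p+q∣≤∣p∣+∣q∣ (f zero) _) (+-monoʳ-≤ ∣ f zero ∣ (∣∑∣≤∑∣∣ (f ∘ suc)))

indicator-refl : ∀ {n} (a : Fin n) → indicator a a ≡ 1ℚ
indicator-refl a with a Fin.≟ a
... | yes _   = refl
... | no  a≢a = contradiction refl a≢a

indicator-≢ : ∀ {n} {a x : Fin n} → x ≢ a → indicator a x ≡ 0ℚ
indicator-≢ {a = a} {x} x≢a with x Fin.≟ a
... | yes x≡a = contradiction x≡a x≢a
... | no  _   = refl

∑-indicator : ∀ {n} a (f : Fin n → ℚ) → ∑ (λ x → indicator a x * f x) ≡ f a
∑-indicator {suc n} a f = begin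
  ∑ g                          ≡⟨ sum-remove {i = a} g ⟩
  g a + ∑ (g ∘ punchIn a)      ≡⟨ cong₂ _+_ (cong (_* f a) (indicator-refl a)) (∑-≗0 off) ⟩
  1ℚ * f a + 0ℚ                ≡⟨ trans (+-identityʳ _) (*-identityˡ (f a)) ⟩
  f a                          ∎
  where
  open ≡-Reasoning
  g = λ x → indicator a x * f x
  off : ∀ i → g (punchIn a i) ≡ 0ℚ
  off i = trans (cong (_* f (punchIn a i)) (indicator-≢ (Fin.punchInᵢ≢i a i)))
                (*-zeroˡ (f (punchIn a i)))

-- Linear algebra

-- Gaussian elimination on the first coordinate. If it vanishes throughout, vector `zero` gets
-- coefficient 0 and the other vectors lose a coordinate; otherwise a pivot vector clears it from
-- the others, and these are dependent by induction.
linearly-dependent : ∀ m (y : Fin (suc m) → Fin m → ℚ) →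
  Σ[ c ∈ (Fin (suc m) → ℚ) ] ((∃[ i ] c i ≢ 0ℚ) × ∀ x → ∑ (λ i → c i * y i x) ≡ 0ℚ)
linearly-dependent zero    y = const 1ℚ , (zero , λ ()) , λ ()
linearly-dependent (suc m) y with Fin.any? (λ i → ¬? (y i zero ≟ 0ℚ))
... | no all-zero =
  let c , (i , cᵢ≢0) , rel = linearly-dependent m (λ i → y (suc i) ∘ suc)
  in insertAt c zero 0ℚ , (suc i , cᵢ≢0) , λ where
       zero    → ∑-≗0 (λ i → trans (cong (insertAt c zero 0ℚ i *_) (head≡0 i)) (*-zeroʳ (insertAt c zero 0ℚ i)))
       (suc x) → trans (cong₂ _+_ (*-zeroˡ (y zero (suc x))) (rel x)) (+-identityˡ 0ℚ)
  where
  head≡0 : ∀ i → y i zero ≡ 0ℚ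
  head≡0 i = decidable-stable (y i zero ≟ 0ℚ) (λ yᵢ≢0 → all-zero (i , yᵢ≢0))
... | yes (j , pivot≢0) =
  let c , (i , cᵢ≢0) , rel = linearly-dependent m (λ i → reduced i ∘ suc)
      -- The coefficient of the pivot cancels the multiples of the pivot vector that were subtracted
      -- in `reduced`.
      cⱼ = - ∑ (λ i → c i * ratio i)
      c⁺ = insertAt c j cⱼ
      reduced-rel : ∀ x → ∑ (λ i → c i * reduced i x) ≡ 0ℚ
      reduced-rel = λ where
        zero    → ∑-≗0 (λ i → trans (cong (c i *_) (reduced-zero i)) (*-zeroʳ (c i)))
        (suc x) → rel x
  in c⁺
   , (punchIn j i , cᵢ≢0 ∘ trans (sym (insertAt-punchIn c j cⱼ i)))
   , λ x → begin
       ∑ (λ i → c⁺ i * y i x)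
         ≡⟨ sum-remove {i = j} (λ i → c⁺ i * y i x) ⟩
       c⁺ j * y j x + ∑ (λ i → c⁺ (punchIn j i) * y (punchIn j i) x)
         ≡⟨ cong₂ _+_ (cong (_* y j x) (insertAt-lookup c j cⱼ))
              (∑-cong λ i → cong (_* y (punchIn j i) x) (insertAt-punchIn c j cⱼ i)) ⟩
       cⱼ * y j x + ∑ (λ i → c i * y (punchIn j i) x)
         ≡⟨ cong (cⱼ * y j x +_) (trans
              (∑-cong λ i → split (c i) (ratio i) (y j x) (y (punchIn j i) x))
              (∑-linear 1ℚ (y j x) (λ i → c i * reduced i x) (λ i → c i * ratio i))) ⟩
       cⱼ * y j x + (1ℚ * ∑ (λ i → c i * reduced i x) + y j x * ∑ (λ i → c i * ratio i))
         ≡⟨ cancel (∑ (λ i → c i * ratio i)) (y j x) _ ⟩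
       ∑ (λ i → c i * reduced i x)
         ≡⟨ reduced-rel x ⟩
       0ℚ ∎
  where
  open ≡-Reasoning
  instance nz = ≢-nonZero pivot≢0
  ratio : Fin (suc m) → ℚ
  ratio i = y (punchIn j i) zero * 1/ y j zero
  reduced : Fin (suc m) → Fin (suc m) → ℚ
  reduced i x = y (punchIn j i) x - ratio i * y j x
  reduced-zero : ∀ i → reduced i zero ≡ 0ℚ
  reduced-zero i = begin
    p - p * 1/ q * q     ≡⟨ cong (λ s → p - s) (*-assoc p (1/ q) q) ⟩
    p - p * (1/ q * q)   ≡⟨ cong (λ r → p - p * r) (*-inverseˡ q) ⟩
    p - p * 1ℚ           ≡⟨ cong (λ s → p - s) (*-identityʳ p) ⟩
    p - p                ≡⟨ +-inverseʳ p ⟩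
    0ℚ                   ∎
    where
    p = y (punchIn j i) zero
    q = y j zero
  split : ∀ c r p q → c * q ≡ 1ℚ * (c * (q - r * p)) + p * (c * r)
  split = solve-∀ ring
  cancel : ∀ s p t → - s * p + (1ℚ * t + p * s) ≡ t
  cancel = solve-∀ ring

-- Vectors are compared pointwise only, so respect for pointwise equality is part of linearity.
record IsLinear {n} (L : (Fin n → ℚ) → Fin n → ℚ) : Set where
  field
    resp-≗   : ∀ {φ ψ} → φ ≗ ψ → L φ ≗ L ψ
    preserves : ∀ c d φ ψ x → L (λ y → c * φ y + d * ψ y) x ≡ c * L φ x + d * L ψ x

  zero-vector : ∀ {φ} → (∀ x → φ x ≡ 0ℚ) → ∀ x → L φ x ≡ 0ℚ
  zero-vector {φ} φ≗0 x = begin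
    L φ x                          ≡⟨ resp-≗ (λ y → trans (φ≗0 y) (sym (null (φ y)))) x ⟩
    L (λ y → 0ℚ * φ y + 0ℚ * φ y) x ≡⟨ preserves 0ℚ 0ℚ φ φ x ⟩
    0ℚ * L φ x + 0ℚ * L φ x        ≡⟨ null (L φ x) ⟩
    0ℚ                             ∎
    where
    open ≡-Reasoning
    null : ∀ p → 0ℚ * p + 0ℚ * p ≡ 0ℚ
    null = solve-∀ ring

  scale : ∀ c φ x → L (λ y → c * φ y) x ≡ c * L φ x
  scale c φ x = begin
    L (λ y → c * φ y) x             ≡⟨ resp-≗ (λ y → null c (φ y)) x ⟩
    L (λ y → c * φ y + 0ℚ * φ y) x  ≡⟨ preserves c 0ℚ φ φ x ⟩
    c * L φ x + 0ℚ * L φ x          ≡⟨ null c (L φ x) ⟨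
    c * L φ x                       ∎
    where
    open ≡-Reasoning
    null : ∀ c p → c * p ≡ c * p + 0ℚ * p
    null = solve-∀ ring

record IsSubspace {n} (K : (Fin n → ℚ) → Set) : Set where
  field
    resp-≗      : ∀ {φ ψ} → φ ≗ ψ → K φ → K ψ
    combination : ∀ c d {φ ψ} → K φ → K ψ → K (λ x → c * φ x + d * ψ x)

module Krylov {n} {L : (Fin n → ℚ) → Fin n → ℚ} (L-linear : IsLinear L)
  {K : (Fin n → ℚ) → Set} (K-subspace : IsSubspace K)
  (L-stable : ∀ {φ} → K φ → K (L φ))
  (L-injective : ∀ {φ} → K φ → (∀ x → L φ x ≡ 0ℚ) → ∀ x → φ x ≡ 0ℚ)
  {u : Fin n → ℚ} (Ku : K u) where

  private
    module L = IsLinear L-linear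
    module K = IsSubspace K-subspace

  power : ℕ → Fin n → ℚ
  power zero    = u
  power (suc k) = L (power k)

  -- The polynomial ∑ cᵢ Lⁱ u in nested form: the constant term stands apart from a single outer
  -- application of `L`, which is what lets `solve-relation` cancel or invert that application.
  horner : ∀ {N} → (Fin N → ℚ) → Fin n → ℚ
  horner {zero}  c x = 0ℚ
  horner {suc N} c x = c zero * u x + 1ℚ * L (horner (c ∘ suc)) x

  K-horner : ∀ {N} (c : Fin N → ℚ) → K (horner c)
  -- The zero vector is reached as 0 u + 0 u, since `IsSubspace` asserts only closure under
  -- combinations.
  K-horner {zero}  c = K.resp-≗ (λ x → null (u x)) (K.combination 0ℚ 0ℚ Ku Ku)
    where
    null : ∀ p → 0ℚ * p + 0ℚ * p ≡ 0ℚ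
    null = solve-∀ ring
  K-horner {suc N} c = K.combination (c zero) 1ℚ Ku (L-stable (K-horner (c ∘ suc)))

  L-∑ : ∀ {N} (c : Fin N → ℚ) (y : Fin N → Fin n → ℚ) x →
        L (λ z → ∑ (λ i → c i * y i z)) x ≡ ∑ (λ i → c i * L (y i) x)
  L-∑ {zero}  c y x = L.zero-vector (λ _ → refl) x
  L-∑ {suc N} c y x = begin
    L (λ z → c zero * y zero z + rest z) x
      ≡⟨ L.resp-≗ (λ z → cong (c zero * y zero z +_) (sym (*-identityˡ (rest z)))) x ⟩
    L (λ z → c zero * y zero z + 1ℚ * rest z) x
      ≡⟨ L.preserves (c zero) 1ℚ (y zero) rest x ⟩
    c zero * L (y zero) x + 1ℚ * L rest x
      ≡⟨ cong (c zero * L (y zero) x +_) (trans (*-identityˡ _) (L-∑ (c ∘ suc) (y ∘ suc) x)) ⟩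
    c zero * L (y zero) x + ∑ (λ i → c (suc i) * L (y (suc i)) x) ∎
    where
    open ≡-Reasoning
    rest = λ z → ∑ (λ i → c (suc i) * y (suc i) z)

  horner≗∑ : ∀ {N} (c : Fin N → ℚ) x → horner c x ≡ ∑ (λ i → c i * power (toℕ i) x)
  horner≗∑ {zero}  c x = refl
  horner≗∑ {suc N} c x = cong (c zero * u x +_)
    (trans (*-identityˡ _) (trans (L.resp-≗ (horner≗∑ (c ∘ suc)) x) (L-∑ (c ∘ suc) _ x)))

  -- A relation ∑ cᵢ Lⁱ u = 0 is divided by its leading power of L, which
  -- leaves c₀ u in the image of L with c₀ ≠ 0.
  solve-relation : ∀ {N} (c : Fin N → ℚ) i → c i ≢ 0ℚ → (∀ x → horner c x ≡ 0ℚ) →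
                   ∃[ w ] (K w × L w ≗ u)
  solve-relation {suc N} c i cᵢ≢0 rel with c zero ≟ 0ℚ
  solve-relation {suc N} c zero cᵢ≢0 rel | yes c₀≡0 = contradiction c₀≡0 cᵢ≢0
  solve-relation {suc N} c (suc i) cᵢ≢0 rel | yes c₀≡0 =
    solve-relation (c ∘ suc) i cᵢ≢0 (L-injective (K-horner (c ∘ suc)) tail≗0)
    where
    drop : ∀ p q → 0ℚ * p + 1ℚ * q ≡ q
    drop = solve-∀ ring
    tail≗0 : ∀ x → L (horner (c ∘ suc)) x ≡ 0ℚ
    tail≗0 x = trans (sym (drop (u x) (L (horner (c ∘ suc)) x)))
      (trans (cong (λ c₀ → c₀ * u x + 1ℚ * L (horner (c ∘ suc)) x) (sym c₀≡0)) (rel x))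
  solve-relation {suc N} c i cᵢ≢0 rel | no c₀≢0 = w , Kw , Lw≗u
    where
    open ≡-Reasoning
    instance nz = ≢-nonZero c₀≢0
    q = 1/ c zero
    t = horner (c ∘ suc)
    w = λ x → - q * t x + 0ℚ * t x
    Kw = K.combination (- q) 0ℚ (K-horner (c ∘ suc)) (K-horner (c ∘ suc))
    regroup : ∀ q c₀ p r → - q * r + 0ℚ * r ≡ q * c₀ * p - q * (c₀ * p + 1ℚ * r)
    regroup = solve-∀ ring
    finish : ∀ q p → 1ℚ * p - q * 0ℚ ≡ p
    finish = solve-∀ ring
    Lw≗u : L w ≗ u
    Lw≗u x = begin
      L w x                                    ≡⟨ L.preserves (- q) 0ℚ t t x ⟩
      - q * L t x + 0ℚ * L t x                 ≡⟨ regroup q (c zero) (u x) (L t x) ⟩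
      q * c zero * u x - q * horner c x
        ≡⟨ cong₂ (λ r s → r * u x - q * s) (*-inverseˡ (c zero)) (rel x) ⟩
      1ℚ * u x - q * 0ℚ                        ≡⟨ finish q (u x) ⟩
      u x                                      ∎

  -- The n + 1 vectors u, L u, ..., Lⁿ u have n coordinates, hence satisfy a nontrivial relation.
  -- The solution is a polynomial in `L` applied to `u`, so it inherits every property expressed by
  -- `K`.
  solvable : ∃[ w ] (K w × L w ≗ u)
  solvable =
    let c , (i , cᵢ≢0) , rel = linearly-dependent n (power ∘ toℕ)
    in solve-relation c i cᵢ≢0 (λ x → trans (horner≗∑ c x) (rel x))

-- Naturals as rationals

-- Division in ℚ reduces to lowest terms and does not compute on a variable numerator; on
-- unnormalised fractions the identity is a cross-multiplication.
fromℕ-suc : ∀ m → fromℕ (suc m) ≡ 1ℚ + fromℕ m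
fromℕ-suc m = toℚᵘ-injective (begin
  toℚᵘ (fromℕ (suc m))           ≈⟨ toℚᵘ-fromℚᵘ (ℚᵘ.mkℚᵘ (ℤ.+ suc m) 0) ⟩
  ℚᵘ.mkℚᵘ (ℤ.+ suc m) 0          ≈⟨ ℚᵘ.*≡* (cong (λ k → (ℤ.1ℤ ℤ.+ k) ℤ.* ℤ.1ℤ) (sym (ℤ.*-identityʳ (ℤ.+ m)))) ⟩
  ℚᵘ.1ℚᵘ ℚᵘ.+ ℚᵘ.mkℚᵘ (ℤ.+ m) 0  ≈⟨ ℚᵘ.+-congʳ ℚᵘ.1ℚᵘ (toℚᵘ-fromℚᵘ (ℚᵘ.mkℚᵘ (ℤ.+ m) 0)) ⟨
  ℚᵘ.1ℚᵘ ℚᵘ.+ toℚᵘ (fromℕ m)     ≈⟨ toℚᵘ-homo-+ 1ℚ (fromℕ m) ⟨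
  toℚᵘ (1ℚ + fromℕ m)            ∎)
  where open ℚᵘ.≃-Reasoning

fromℕ-nonNeg : ∀ m → 0ℚ ≤ fromℕ m
fromℕ-nonNeg zero    = ≤-refl
fromℕ-nonNeg (suc m) = subst (0ℚ ≤_) (sym (fromℕ-suc m)) (+-nonNeg (nonNegative⁻¹ 1ℚ) (fromℕ-nonNeg m))

fromℕ-mono : ∀ {k m} → k ℕ.≤ m → fromℕ k ≤ fromℕ m
fromℕ-mono {m = m} ℕ.z≤n       = fromℕ-nonNeg m
fromℕ-mono (ℕ.s≤s {k} {m} k≤m) =
  subst₂ _≤_ (sym (fromℕ-suc k)) (sym (fromℕ-suc m)) (+-monoʳ-≤ 1ℚ (fromℕ-mono k≤m))

reciprocal-inverse : ∀ m → reciprocal (suc m) * fromℕ (suc m) ≡ 1ℚ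
reciprocal-inverse m = toℚᵘ-injective (begin
  toℚᵘ (reciprocal (suc m) * fromℕ (suc m))
    ≈⟨ toℚᵘ-homo-* (reciprocal (suc m)) (fromℕ (suc m)) ⟩
  toℚᵘ (reciprocal (suc m)) ℚᵘ.* toℚᵘ (fromℕ (suc m))
    ≈⟨ ℚᵘ.*-cong (toℚᵘ-fromℚᵘ (ℚᵘ.mkℚᵘ (ℤ.+ 1) m)) (toℚᵘ-fromℚᵘ (ℚᵘ.mkℚᵘ (ℤ.+ suc m) 0)) ⟩
  ℚᵘ.mkℚᵘ (ℤ.+ 1) m ℚᵘ.* ℚᵘ.mkℚᵘ (ℤ.+ suc m) 0
    ≈⟨ ℚᵘ.*≡* (ℤ.*-assoc ℤ.1ℤ (ℤ.+ suc m) ℤ.1ℤ) ⟩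
  ℚᵘ.1ℚᵘ ∎)
  where open ℚᵘ.≃-Reasoning

reciprocal-nonNeg : ∀ m → 0ℚ ≤ reciprocal m
reciprocal-nonNeg zero    = ≤-refl
reciprocal-nonNeg (suc m) = nonNegative⁻¹ _ {{normalize-nonNeg 1 (suc m)}}

-- The numerator of a nonnegative fraction already bounds it; a negative one is bounded by 0.
archimedean : ∀ p → ∃[ m ] p ≤ fromℕ m
archimedean (mkℚ (ℤ.-[1+ k ]) d _) = 0 , *≤* ℤ.-≤+
archimedean p@(mkℚ (ℤ.+ k) d _) = k , toℚᵘ-cancel-≤ (begin
  ℚᵘ.mkℚᵘ (ℤ.+ k) d  ≤⟨ ℚᵘ.*≤* (ℤ.*-monoˡ-≤-nonNeg (ℤ.+ k) (ℤ.+≤+ (ℕ.s≤s ℕ.z≤n))) ⟩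
  ℚᵘ.mkℚᵘ (ℤ.+ k) 0  ≃⟨ toℚᵘ-fromℚᵘ (ℚᵘ.mkℚᵘ (ℤ.+ k) 0) ⟨
  toℚᵘ (fromℕ k)     ∎)
  where open ℚᵘ.≤-Reasoning

-- Iverson brackets and sums over lists

-- Only the boolean of the decision enters, so filters, conjunctions and negations are handled by
-- cases on booleans, whatever the proofs inside.
⟦_⟧ : {P : Set} → Dec P → ℚ
⟦ p? ⟧ = if does p? then 1ℚ else 0ℚ

⟦⟧-nonNeg : {P : Set} (p? : Dec P) → 0ℚ ≤ ⟦ p? ⟧
⟦⟧-nonNeg p? with does p?
... | true  = nonNegative⁻¹ 1ℚ
... | false = ≤-refl

⟦⟧-true : {P : Set} (p? : Dec P) → P → ⟦ p? ⟧ ≡ 1ℚ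
⟦⟧-true p? p = cong (if_then 1ℚ else 0ℚ) (dec-true p? p)

⟦⟧-false : {P : Set} (p? : Dec P) → ¬ P → ⟦ p? ⟧ ≡ 0ℚ
⟦⟧-false p? ¬p = cong (if_then 1ℚ else 0ℚ) (dec-false p? ¬p)

⟦⟧-cong : {P Q : Set} (p? : Dec P) (q? : Dec Q) → (P → Q) → (Q → P) → ⟦ p? ⟧ ≡ ⟦ q? ⟧
⟦⟧-cong (yes p) q? to from = sym (⟦⟧-true q? (to p))
⟦⟧-cong (no ¬p) q? to from = sym (⟦⟧-false q? (¬p ∘ from))

⟦⟧-× : {P Q : Set} (p? : Dec P) (q? : Dec Q) → ⟦ p? ×-dec q? ⟧ ≡ ⟦ p? ⟧ * ⟦ q? ⟧
⟦⟧-× p? q? with does p? | does q?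
... | true  | true  = refl
... | true  | false = refl
... | false | true  = refl
... | false | false = refl

⟦⟧-¬ : {P : Set} (p? : Dec P) → ⟦ ¬? p? ⟧ ≡ 1ℚ - ⟦ p? ⟧
⟦⟧-¬ p? with does p?
... | true  = refl
... | false = refl

⟦⟧-square : {P : Set} (p? : Dec P) → ⟦ p? ⟧ * ⟦ p? ⟧ ≡ ⟦ p? ⟧
⟦⟧-square p? with does p?
... | true  = refl
... | false = refl

indicator≡⟦⟧ : ∀ {n} (a x : Fin n) → indicator a x ≡ ⟦ x Fin.≟ a ⟧
indicator≡⟦⟧ a x with x Fin.≟ a
... | yes _ = refl
... | no  _ = refl

module _ {A : Set} where

  sumOver-cong : ∀ (xs : List A) {f g : A → ℚ} → f ≗ g → sumOver xs f ≡ sumOver xs g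
  sumOver-cong []       f≗g = refl
  sumOver-cong (x ∷ xs) f≗g = cong₂ _+_ (f≗g x) (sumOver-cong xs f≗g)

  sumOver-*ˡ : ∀ (xs : List A) c (f : A → ℚ) → sumOver xs (λ x → c * f x) ≡ c * sumOver xs f
  sumOver-*ˡ []       c f = sym (*-zeroʳ c)
  sumOver-*ˡ (x ∷ xs) c f =
    trans (cong (c * f x +_) (sumOver-*ˡ xs c f)) (sym (*-distribˡ-+ c (f x) (sumOver xs f)))

  sumOver-++ : ∀ (xs ys : List A) (f : A → ℚ) → sumOver (xs ++ ys) f ≡ sumOver xs f + sumOver ys f
  sumOver-++ []       ys f = sym (+-identityˡ (sumOver ys f))
  sumOver-++ (x ∷ xs) ys f =
    trans (cong (f x +_) (sumOver-++ xs ys f)) (sym (+-assoc (f x) (sumOver xs f) (sumOver ys f)))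

  sumOver-map : ∀ {B : Set} (g : B → A) (xs : List B) (f : A → ℚ) →
                sumOver (map g xs) f ≡ sumOver xs (f ∘ g)
  sumOver-map g []       f = refl
  sumOver-map g (x ∷ xs) f = cong (f (g x) +_) (sumOver-map g xs f)

  sumOver-filter : ∀ {P : A → Set} (P? : Decidable P) xs (f : A → ℚ) →
                   sumOver (filter P? xs) f ≡ sumOver xs (λ x → ⟦ P? x ⟧ * f x)
  sumOver-filter P? []       f = refl
  sumOver-filter P? (x ∷ xs) f with does (P? x)
  ... | true  = cong₂ _+_ (sym (*-identityˡ (f x))) (sumOver-filter P? xs f)
  ... | false = begin
    sumOver (filter P? xs) f            ≡⟨ sumOver-filter P? xs f ⟩
    rest                                ≡⟨ +-identityˡ rest ⟨
    0ℚ + rest                           ≡⟨ cong (_+ rest) (*-zeroˡ (f x)) ⟨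
    0ℚ * f x + rest                     ∎
    where
    open ≡-Reasoning
    rest = sumOver xs (λ x → ⟦ P? x ⟧ * f x)

  fromℕ-length : ∀ (xs : List A) → fromℕ (length xs) ≡ sumOver xs (const 1ℚ)
  fromℕ-length []       = refl
  fromℕ-length (x ∷ xs) = trans (fromℕ-suc (length xs)) (cong (1ℚ +_) (fromℕ-length xs))

  fromℕ-count : ∀ {P : A → Set} (P? : Decidable P) xs →
                fromℕ (length (filter P? xs)) ≡ sumOver xs (λ x → ⟦ P? x ⟧)
  fromℕ-count P? xs =
    trans (fromℕ-length (filter P? xs))
    (trans (sumOver-filter P? xs (const 1ℚ)) (sumOver-cong xs (λ x → *-identityʳ ⟦ P? x ⟧)))

sumOver-cartesianProductWith : ∀ {A B C : Set} (g : A → B → C) xs ys (f : C → ℚ) →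
  sumOver (cartesianProductWith g xs ys) f ≡ sumOver xs (λ x → sumOver ys (λ y → f (g x y)))
sumOver-cartesianProductWith g []       ys f = refl
sumOver-cartesianProductWith g (x ∷ xs) ys f =
  trans (sumOver-++ (map (g x) ys) _ f)
    (cong₂ _+_ (sumOver-map (g x) ys f) (sumOver-cartesianProductWith g xs ys f))

sumOver-tabulate : ∀ {A : Set} {n} (g : Fin n → A) (f : A → ℚ) → sumOver (tabulate g) f ≡ ∑ (f ∘ g)
sumOver-tabulate {n = zero}  g f = refl
sumOver-tabulate {n = suc n} g f = cong (f (g zero) +_) (sumOver-tabulate (g ∘ suc) f)

sumOver-allFin : ∀ {n} (f : Fin n → ℚ) → sumOver (allFin n) f ≡ ∑ f
sumOver-allFin = sumOver-tabulate (λ i → i)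

-- The graph Laplacian: self-adjointness and energy.

module Network {n} (G : Graph n) where
  open Graph G using (adj?; irrefl) renaming (sym to adj-sym)

  weight : Fin n → Fin n → ℚ
  weight x y = ⟦ adj? x y ⟧

  weight-sym : ∀ x y → weight x y ≡ weight y x
  weight-sym x y = ⟦⟧-cong (adj? x y) (adj? y x) adj-sym adj-sym

  weight-irrefl : ∀ x → weight x x ≡ 0ℚ
  weight-irrefl x = ⟦⟧-false (adj? x x) (irrefl refl)

  degree : Fin n → ℚ
  degree x = ∑ (weight x)

  totalDegree : ℚ
  totalDegree = ∑ degree

  fromℕ-deg : ∀ x → fromℕ (deg G x) ≡ degree x
  fromℕ-deg x = trans (fromℕ-count (adj? x) (allFin n)) (sumOver-allFin (weight x))

  lap : (Fin n → ℚ) → Fin n → ℚ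
  lap φ x = ∑ (λ y → weight x y * (φ x - φ y))

  lap-neighbours : ∀ (φ : Fin n → ℚ) x → sumOver (neighbours G x) (λ y → φ x - φ y) ≡ lap φ x
  lap-neighbours φ x =
    trans (sumOver-filter (adj? x) (allFin n) (λ y → φ x - φ y))
          (sumOver-allFin (λ y → weight x y * (φ x - φ y)))

  adjacency : (Fin n → ℚ) → Fin n → ℚ
  adjacency φ x = ∑ (λ y → weight x y * φ y)

  lap-adjacency : ∀ (φ : Fin n → ℚ) x → lap φ x ≡ degree x * φ x - adjacency φ x
  lap-adjacency φ x = begin
    ∑ (λ y → weight x y * (φ x - φ y))
      ≡⟨ ∑-cong (λ y → expand (weight x y) (φ x) (φ y)) ⟩
    ∑ (λ y → φ x * weight x y - weight x y * φ y)
      ≡⟨ ∑-distrib-- (λ y → φ x * weight x y) (λ y → weight x y * φ y) ⟩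
    ∑ (λ y → φ x * weight x y) - adjacency φ x
      ≡⟨ cong (_- adjacency φ x) (trans (∑-*ˡ (φ x) (weight x)) (*-comm (φ x) (degree x))) ⟩
    degree x * φ x - adjacency φ x ∎
    where
    open ≡-Reasoning
    expand : ∀ w p q → w * (p - q) ≡ p * w - w * q
    expand = solve-∀ ring

  lap-linear : IsLinear lap
  lap-linear = record
    { resp-≗    = λ φ≗ψ x → ∑-cong (λ y → cong₂ (λ p q → weight x y * (p - q)) (φ≗ψ x) (φ≗ψ y))
    ; preserves = λ c d φ ψ x → trans
        (∑-cong λ y → expand c d (weight x y) (φ x) (φ y) (ψ x) (ψ y))
        (∑-linear c d (λ y → weight x y * (φ x - φ y)) (λ y → weight x y * (ψ x - ψ y)))
    }
    where
    expand : ∀ c d w p q r s →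
             w * (c * p + d * r - (c * q + d * s)) ≡ c * (w * (p - q)) + d * (w * (r - s))
    expand = solve-∀ ring

  ∑∑-weight-sym : ∀ (F : Fin n → Fin n → ℚ) →
    ∑ (λ x → ∑ (λ y → weight x y * F x y)) ≡ ∑ (λ x → ∑ (λ y → weight x y * F y x))
  ∑∑-weight-sym F = trans (∑-comm (λ x y → weight x y * F x y))
    (∑-cong λ x → ∑-cong λ y → cong (_* F y x) (weight-sym y x))

  -- Both orientations of an edge are added up, so no division by two occurs.
  lap-pairing : ∀ (φ ψ : Fin n → ℚ) → ∑ (λ x → ψ x * lap φ x) + ∑ (λ x → ψ x * lap φ x)
                      ≡ ∑ (λ x → ∑ (λ y → weight x y * ((φ x - φ y) * (ψ x - ψ y))))
  lap-pairing φ ψ = begin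
    S + S
      ≡⟨ cong₂ _+_ S≡ (trans S≡ (∑∑-weight-sym F)) ⟩
    ∑ (λ x → ∑ (λ y → weight x y * F x y)) + ∑ (λ x → ∑ (λ y → weight x y * F y x))
      ≡⟨ ∑-distrib-+ (λ x → ∑ (λ y → weight x y * F x y)) (λ x → ∑ (λ y → weight x y * F y x)) ⟨
    ∑ (λ x → ∑ (λ y → weight x y * F x y) + ∑ (λ y → weight x y * F y x))
      ≡⟨ ∑-cong (λ x → sym (∑-distrib-+ (λ y → weight x y * F x y) (λ y → weight x y * F y x))) ⟩
    ∑ (λ x → ∑ (λ y → weight x y * F x y + weight x y * F y x))
      ≡⟨ ∑-cong (λ x → ∑-cong λ y → combine (weight x y) (φ x) (φ y) (ψ x) (ψ y)) ⟩
    ∑ (λ x → ∑ (λ y → weight x y * ((φ x - φ y) * (ψ x - ψ y)))) ∎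
    where
    open ≡-Reasoning
    S = ∑ (λ x → ψ x * lap φ x)
    F : Fin n → Fin n → ℚ
    F x y = ψ x * (φ x - φ y)
    move : ∀ w p q → p * (w * q) ≡ w * (p * q)
    move = solve-∀ ring
    S≡ : S ≡ ∑ (λ x → ∑ (λ y → weight x y * F x y))
    S≡ = ∑-cong λ x → trans (sym (∑-*ˡ (ψ x) (λ y → weight x y * (φ x - φ y))))
                            (∑-cong λ y → move (weight x y) (ψ x) (φ x - φ y))
    combine : ∀ w p q r s → w * (r * (p - q)) + w * (s * (q - p)) ≡ w * ((p - q) * (r - s))
    combine = solve-∀ ring

  -- Twice either side is the sum over ordered pairs in `lap-pairing`, which is symmetric in φ and
  -- ψ; the factor 2 is then cancelled.
  lap-self-adjoint : ∀ (φ ψ : Fin n → ℚ) → ∑ (λ x → ψ x * lap φ x) ≡ ∑ (λ x → φ x * lap ψ x)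
  lap-self-adjoint φ ψ = double-injective (begin
    S + S   ≡⟨ lap-pairing φ ψ ⟩
    ∑ (λ x → ∑ (λ y → weight x y * ((φ x - φ y) * (ψ x - ψ y))))
      ≡⟨ ∑-cong (λ x → ∑-cong λ y → cong (weight x y *_) (*-comm (φ x - φ y) (ψ x - ψ y))) ⟩
    ∑ (λ x → ∑ (λ y → weight x y * ((ψ x - ψ y) * (φ x - φ y))))
      ≡⟨ lap-pairing ψ φ ⟨
    T + T   ∎)
    where
    open ≡-Reasoning
    S = ∑ (λ x → ψ x * lap φ x)
    T = ∑ (λ x → φ x * lap ψ x)
    double : ∀ p → p + p ≡ (1ℚ + 1ℚ) * p
    double = solve-∀ ring
    double-injective : S + S ≡ T + T → S ≡ T
    double-injective eq = *-cancelˡ-≢0 {r = 1ℚ + 1ℚ} (λ ()) (trans (sym (double S)) (trans eq (double T)))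

  -- Self-adjointness against the constant 1, whose Laplacian vanishes.
  ∑-lap : ∀ (φ : Fin n → ℚ) → ∑ (lap φ) ≡ 0ℚ
  ∑-lap φ = begin
    ∑ (lap φ)                      ≡⟨ ∑-cong (λ x → *-identityˡ (lap φ x)) ⟨
    ∑ (λ x → 1ℚ * lap φ x)         ≡⟨ lap-self-adjoint φ (const 1ℚ) ⟩
    ∑ (λ x → φ x * lap (const 1ℚ) x)
      ≡⟨ ∑-≗0 (λ x → trans (cong (φ x *_) (∑-≗0 λ y → *-zeroʳ (weight x y))) (*-zeroʳ (φ x))) ⟩
    0ℚ                             ∎
    where open ≡-Reasoning

  private
    energy-terms-nonNeg : ∀ (φ : Fin n → ℚ) x y → 0ℚ ≤ weight x y * ((φ x - φ y) * (φ x - φ y))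
    energy-terms-nonNeg φ x y = *-nonNeg (⟦⟧-nonNeg (adj? x y)) (square-nonNeg (φ x - φ y))

  energy-nonNeg : ∀ (φ : Fin n → ℚ) → 0ℚ ≤ ∑ (λ x → φ x * lap φ x)
  energy-nonNeg φ with ≤-total 0ℚ E
    where E = ∑ (λ x → φ x * lap φ x)
  ... | inj₁ 0≤E = 0≤E
  -- Only E + E is known to be a sum of nonnegative terms; if E ≤ 0 then 0 ≤ E + E ≤ E.
  ... | inj₂ E≤0 = ≤-trans (subst (0ℚ ≤_) (sym (lap-pairing φ φ))
          (∑-nonNeg λ x → ∑-nonNeg λ y → energy-terms-nonNeg φ x y))
          (subst (E + E ≤_) (+-identityʳ E) (+-monoʳ-≤ E E≤0))
    where E = ∑ (λ x → φ x * lap φ x)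

  -- Each squared difference across an edge must vanish, and equality of endpoint values propagates
  -- along paths.
  energy≡0⇒constant : Connected G → ∀ (φ : Fin n → ℚ) → ∑ (λ x → φ x * lap φ x) ≡ 0ℚ → ∀ x y → φ x ≡ φ y
  energy≡0⇒constant connected φ E≡0 x y =
    fold (λ x y → φ x ≡ φ y) (λ {x} adj φy≡φz → trans (step adj) φy≡φz) refl (connected x y)
    where
    terms≡0 : ∀ x y → weight x y * ((φ x - φ y) * (φ x - φ y)) ≡ 0ℚ
    terms≡0 x = ∑≡0⇒≗0 (energy-terms-nonNeg φ x)
      (∑≡0⇒≗0 (λ x → ∑-nonNeg (energy-terms-nonNeg φ x))
        (trans (sym (lap-pairing φ φ)) (cong₂ _+_ E≡0 E≡0)) x)
    step : ∀ {x y} → Adj G x y → φ x ≡ φ y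
    step {x} {y} adj = p-q≡0⇒p≡q (square≡0 (trans (sym (*-identityˡ _))
      (subst (λ w → w * ((φ x - φ y) * (φ x - φ y)) ≡ 0ℚ) (⟦⟧-true (adj? x y) adj) (terms≡0 x y))))

  lap≡0⇒constant : Connected G → ∀ (φ : Fin n → ℚ) → (∀ x → lap φ x ≡ 0ℚ) → ∀ x y → φ x ≡ φ y
  lap≡0⇒constant connected φ lap≡0 =
    energy≡0⇒constant connected φ (∑-≗0 λ x → trans (cong (φ x *_) (lap≡0 x)) (*-zeroʳ (φ x)))

-- Inner products, the unit source-sink vector and mean-zero functions.

⟨_,_⟩ : ∀ {n} → (Fin n → ℚ) → (Fin n → ℚ) → ℚ
⟨ φ , ψ ⟩ = ∑ (λ x → φ x * ψ x)

⟨⟩-comm : ∀ {n} (φ ψ : Fin n → ℚ) → ⟨ φ , ψ ⟩ ≡ ⟨ ψ , φ ⟩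
⟨⟩-comm φ ψ = ∑-cong λ x → *-comm (φ x) (ψ x)

⟨⟩-congʳ : ∀ {n} (χ : Fin n → ℚ) {φ ψ : Fin n → ℚ} → φ ≗ ψ → ⟨ χ , φ ⟩ ≡ ⟨ χ , ψ ⟩
⟨⟩-congʳ χ φ≗ψ = ∑-cong λ x → cong (χ x *_) (φ≗ψ x)

⟨⟩-linearʳ : ∀ {n} (χ : Fin n → ℚ) c d (φ ψ : Fin n → ℚ) →
             ⟨ χ , (λ x → c * φ x + d * ψ x) ⟩ ≡ c * ⟨ χ , φ ⟩ + d * ⟨ χ , ψ ⟩
⟨⟩-linearʳ χ c d φ ψ = trans
  (∑-cong λ x → expand c d (χ x) (φ x) (ψ x))
  (∑-linear c d (λ x → χ x * φ x) (λ x → χ x * ψ x))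
  where
  expand : ∀ c d r p q → r * (c * p + d * q) ≡ c * (r * p) + d * (r * q)
  expand = solve-∀ ring

⟨⟩-subʳ : ∀ {n} (χ φ ψ : Fin n → ℚ) → ⟨ χ , (λ x → φ x - ψ x) ⟩ ≡ ⟨ χ , φ ⟩ - ⟨ χ , ψ ⟩
⟨⟩-subʳ χ φ ψ = trans
  (∑-cong λ x → expand (χ x) (φ x) (ψ x))
  (∑-distrib-- (λ x → χ x * φ x) (λ x → χ x * ψ x))
  where
  expand : ∀ r p q → r * (p - q) ≡ r * p - r * q
  expand = solve-∀ ring

∑-indicator≡1 : ∀ {n} (a : Fin n) → ∑ (indicator a) ≡ 1ℚ
∑-indicator≡1 a = trans (∑-cong λ x → sym (*-identityʳ (indicator a x))) (∑-indicator a (const 1ℚ))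

source-sink : ∀ {n} → Fin n → Fin n → Fin n → ℚ
source-sink a b x = indicator a x - indicator b x

⟨source-sink⟩ : ∀ {n} (a b : Fin n) (f : Fin n → ℚ) → ⟨ f , source-sink a b ⟩ ≡ f a - f b
⟨source-sink⟩ a b f = trans (⟨⟩-subʳ f (indicator a) (indicator b))
  (cong₂ _-_ (trans (⟨⟩-comm f (indicator a)) (∑-indicator a f))
             (trans (⟨⟩-comm f (indicator b)) (∑-indicator b f)))

MeanZero : ∀ {n} → (Fin n → ℚ) → Set
MeanZero φ = ∑ φ ≡ 0ℚ

meanZero-combination : ∀ {n} c d {φ ψ : Fin n → ℚ} → MeanZero φ → MeanZero ψ →
                       MeanZero (λ x → c * φ x + d * ψ x)
meanZero-combination c d {φ} {ψ} ∑φ≡0 ∑ψ≡0 = begin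
  ∑ (λ x → c * φ x + d * ψ x)  ≡⟨ ∑-linear c d φ ψ ⟩
  c * ∑ φ + d * ∑ ψ            ≡⟨ cong₂ (λ p q → c * p + d * q) ∑φ≡0 ∑ψ≡0 ⟩
  c * 0ℚ + d * 0ℚ              ≡⟨ vanish c d ⟩
  0ℚ                           ∎
  where
  open ≡-Reasoning
  vanish : ∀ c d → c * 0ℚ + d * 0ℚ ≡ 0ℚ
  vanish = solve-∀ ring

meanZero-subspace : ∀ {n} → IsSubspace (MeanZero {n})
meanZero-subspace = record
  { resp-≗      = λ φ≗ψ ∑φ≡0 → trans (sym (∑-cong φ≗ψ)) ∑φ≡0
  ; combination = λ c d {φ} {ψ} → meanZero-combination c d {φ} {ψ}
  }

-- The sum is φ x times the number of vertices, and that number, written as a sum of ones, is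
-- positive because x itself contributes.
meanZero-constant : ∀ {n} {φ : Fin n → ℚ} → MeanZero φ → (∀ x y → φ x ≡ φ y) → ∀ x → φ x ≡ 0ℚ
meanZero-constant {n} {φ} ∑φ≡0 constant x = p*q≡0⇒q≡0 {∑ {n} (const 1ℚ)} ∑1≢0 (begin
  ∑ {n} (const 1ℚ) * φ x     ≡⟨ *-comm (∑ {n} (const 1ℚ)) (φ x) ⟩
  φ x * ∑ {n} (const 1ℚ)     ≡⟨ ∑-*ˡ {n} (φ x) (const 1ℚ) ⟨
  ∑ {n} (λ _ → φ x * 1ℚ)     ≡⟨ ∑-cong (λ y → trans (*-identityʳ (φ x)) (constant x y)) ⟩
  ∑ φ                        ≡⟨ ∑φ≡0 ⟩
  0ℚ                         ∎)
  where
  open ≡-Reasoning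
  ∑1≢0 : ∑ {n} (const 1ℚ) ≢ 0ℚ
  ∑1≢0 ∑1≡0 = <⇒≢ (<-≤-trans (positive⁻¹ 1ℚ) (term≤∑ {n} {const 1ℚ} (λ _ → nonNegative⁻¹ 1ℚ) x)) (sym ∑1≡0)

-- The Poisson equation and effective resistance on a connected graph.

module Poisson {n} (G : Graph n) (connected : Connected G) where
  open Network G

  lap-injective : ∀ {φ : Fin n → ℚ} → MeanZero φ → (∀ x → lap φ x ≡ 0ℚ) → ∀ x → φ x ≡ 0ℚ
  lap-injective {φ} ∑φ≡0 lap≡0 = meanZero-constant ∑φ≡0 (lap≡0⇒constant connected φ lap≡0)

  -- The Krylov argument on the mean-zero functions: the Laplacian maps into them, and its kernel,
  -- the constants, meets them only in 0.
  lap-surjective : ∀ {u : Fin n → ℚ} → MeanZero u → ∃[ w ] lap w ≗ u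
  lap-surjective ∑u≡0 =
    let w , _ , lap-w≗u = Krylov.solvable lap-linear meanZero-subspace
          (λ {φ} _ → ∑-lap φ) lap-injective ∑u≡0
    in w , lap-w≗u

  -- Both differences equal ⟨ w , lap v ⟩ by self-adjointness, so uniqueness of the voltage up to a
  -- constant never has to be stated.
  unit-voltage-difference : ∀ {a b} {v w : Fin n → ℚ} →
    lap v ≗ source-sink a b → lap w ≗ source-sink a b → w a - w b ≡ v a - v b
  unit-voltage-difference {a} {b} {v} {w} lap-v lap-w = begin
    w a - w b                ≡⟨ ⟨source-sink⟩ a b w ⟨
    ⟨ w , source-sink a b ⟩  ≡⟨ ⟨⟩-congʳ w lap-v ⟨
    ⟨ w , lap v ⟩            ≡⟨ lap-self-adjoint v w ⟩
    ⟨ v , lap w ⟩            ≡⟨ ⟨⟩-congʳ v lap-w ⟩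
    ⟨ v , source-sink a b ⟩  ≡⟨ ⟨source-sink⟩ a b v ⟩
    v a - v b                ∎
    where open ≡-Reasoning

  effective-resistance : ∀ {a b} {v : Fin n → ℚ} → lap v ≗ source-sink a b →
                         IsEffectiveResistance G a b (v a - v b)
  effective-resistance {v = v} lap-v =
      (v , λ x → trans (lap-neighbours v x) (lap-v x))
    , λ w unit → unit-voltage-difference {v = v} {w} lap-v (λ x → trans (sym (lap-neighbours w x)) (unit x))

  -- The difference is the energy ⟨ v , lap v ⟩, hence nonnegative; if it were zero, v would be
  -- constant and no current would leave `a`.
  voltage-difference-pos : ∀ {a b} {v : Fin n → ℚ} → a ≢ b → lap v ≗ source-sink a b → 0ℚ < v a - v b
  voltage-difference-pos {a} {b} {v} a≢b lap-v with <-cmp 0ℚ (v a - v b)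
  ... | tri< 0<R _ _ = 0<R
  ... | tri> _ _ R<0 =
    contradiction (<-≤-trans R<0 (subst (0ℚ ≤_) (trans (⟨⟩-congʳ v lap-v) (⟨source-sink⟩ a b v)) (energy-nonNeg v)))
      (<-irrefl refl)
  ... | tri≈ _ 0≡R _ = contradiction (trans (sym lap-v-a) lap-v-a≡0) λ ()
    where
    constant : ∀ x y → v x ≡ v y
    constant = energy≡0⇒constant connected v
      (trans (⟨⟩-congʳ v lap-v) (trans (⟨source-sink⟩ a b v) (sym 0≡R)))
    lap-v-a≡0 : lap v a ≡ 0ℚ
    lap-v-a≡0 = ∑-≗0 λ y → trans (cong (λ p → weight a y * (v a - p)) (constant y a))
      (trans (cong (weight a y *_) (+-inverseʳ (v a))) (*-zeroʳ (weight a y)))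
    lap-v-a : lap v a ≡ 1ℚ
    lap-v-a = trans (lap-v a) (cong₂ _-_ (indicator-refl a) (indicator-≢ a≢b))

-- Walk counts as entries of powers of the adjacency matrix.

module Walks {n} (G : Graph n) where
  open Network G

  adjacency-self-adjoint : ∀ (φ ψ : Fin n → ℚ) → ⟨ adjacency φ , ψ ⟩ ≡ ⟨ φ , adjacency ψ ⟩
  adjacency-self-adjoint φ ψ = begin
    ⟨ adjacency φ , ψ ⟩
      ≡⟨ ∑-cong (λ x → trans (*-comm (adjacency φ x) (ψ x)) (expand ψ φ x)) ⟩
    ∑ (λ x → ∑ (λ y → weight x y * (ψ x * φ y)))
      ≡⟨ ∑∑-weight-sym (λ x y → ψ x * φ y) ⟩
    ∑ (λ x → ∑ (λ y → weight x y * (ψ y * φ x)))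
      ≡⟨ ∑-cong (λ x → ∑-cong λ y → cong (weight x y *_) (*-comm (ψ y) (φ x))) ⟩
    ∑ (λ x → ∑ (λ y → weight x y * (φ x * ψ y)))
      ≡⟨ ∑-cong (λ x → expand φ ψ x) ⟨
    ⟨ φ , adjacency ψ ⟩ ∎
    where
    open ≡-Reasoning
    move : ∀ p w q → p * (w * q) ≡ w * (p * q)
    move = solve-∀ ring
    expand : ∀ (φ ψ : Fin n → ℚ) x → φ x * adjacency ψ x ≡ ∑ (λ y → weight x y * (φ x * ψ y))
    expand φ ψ x = trans (sym (∑-*ˡ (φ x) (λ y → weight x y * ψ y)))
                         (∑-cong λ y → move (φ x) (weight x y) (ψ y))

  adjacency^ : ℕ → (Fin n → ℚ) → Fin n → ℚ
  adjacency^ zero    φ = φ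
  adjacency^ (suc k) φ = adjacency (adjacency^ k φ)

  -- One factor at a time moves to the right; the exponent `k` accumulates them, so it must be free
  -- in the induction.
  adjacency^-adjoint : ∀ j k (φ ψ : Fin n → ℚ) →
    ⟨ adjacency^ j φ , adjacency^ k ψ ⟩ ≡ ⟨ φ , adjacency^ (j ℕ.+ k) ψ ⟩
  adjacency^-adjoint zero    k φ ψ = refl
  adjacency^-adjoint (suc j) k φ ψ = begin
    ⟨ adjacency (adjacency^ j φ) , adjacency^ k ψ ⟩
      ≡⟨ adjacency-self-adjoint (adjacency^ j φ) (adjacency^ k ψ) ⟩
    ⟨ adjacency^ j φ , adjacency^ (suc k) ψ ⟩
      ≡⟨ adjacency^-adjoint j (suc k) φ ψ ⟩
    ⟨ φ , adjacency^ (j ℕ.+ suc k) ψ ⟩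
      ≡⟨ cong (λ i → ⟨ φ , adjacency^ i ψ ⟩) (ℕ.+-suc j k) ⟩
    ⟨ φ , adjacency^ (suc j ℕ.+ k) ψ ⟩ ∎
    where open ≡-Reasoning

  walks-sym : ∀ k x z → adjacency^ k (indicator z) x ≡ adjacency^ k (indicator x) z
  walks-sym k x z = begin
    adjacency^ k (indicator z) x                ≡⟨ ∑-indicator x _ ⟨
    ⟨ indicator x , adjacency^ k (indicator z) ⟩
      ≡⟨ cong (λ i → ⟨ indicator x , adjacency^ i (indicator z) ⟩) (sym (ℕ.+-identityʳ k)) ⟩
    ⟨ indicator x , adjacency^ (k ℕ.+ 0) (indicator z) ⟩ ≡⟨ adjacency^-adjoint k 0 (indicator x) (indicator z) ⟨
    ⟨ adjacency^ k (indicator x) , indicator z ⟩ ≡⟨ ⟨⟩-comm (adjacency^ k (indicator x)) (indicator z) ⟩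
    ⟨ indicator z , adjacency^ k (indicator x) ⟩ ≡⟨ ∑-indicator z _ ⟩
    adjacency^ k (indicator x) z                ∎
    where open ≡-Reasoning

  -- The endpoint z is kept separate from x because removing the first step of a closed walk leaves
  -- a walk that is no longer closed.
  walk-count : ∀ k x z →
    sumOver (allVecs k) (λ ys → ⟦ isWalk? G x ys ⟧ * ⟦ last (x ∷ᵛ ys) Fin.≟ z ⟧) ≡ adjacency^ k (indicator z) x
  walk-count zero    x z = trans (+-identityʳ _) (trans (*-identityˡ _) (sym (indicator≡⟦⟧ z x)))
  walk-count (suc k) x z = begin
    sumOver (allVecs (suc k)) (λ ys → ⟦ isWalk? G x ys ⟧ * ⟦ last (x ∷ᵛ ys) Fin.≟ z ⟧)
      ≡⟨ sumOver-cartesianProductWith _∷ᵛ_ (allFin n) (allVecs k) _ ⟩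
    sumOver (allFin n) (λ y → sumOver (allVecs k) (λ ys →
      ⟦ Graph.adj? G x y ×-dec isWalk? G y ys ⟧ * ⟦ last (y ∷ᵛ ys) Fin.≟ z ⟧))
      ≡⟨ sumOver-allFin {n} _ ⟩
    ∑ (λ y → sumOver (allVecs k) (λ ys →
      ⟦ Graph.adj? G x y ×-dec isWalk? G y ys ⟧ * ⟦ last (y ∷ᵛ ys) Fin.≟ z ⟧))
      ≡⟨ ∑-cong (λ y → trans (sumOver-cong (allVecs k) (first-step y)) (sumOver-*ˡ (allVecs k) (weight x y) _)) ⟩
    ∑ (λ y → weight x y * sumOver (allVecs k) (λ ys → ⟦ isWalk? G y ys ⟧ * ⟦ last (y ∷ᵛ ys) Fin.≟ z ⟧))
      ≡⟨ ∑-cong (λ y → cong (weight x y *_) (walk-count k y z)) ⟩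
    adjacency^ (suc k) (indicator z) x ∎
    where
    open ≡-Reasoning
    first-step : ∀ y (ys : Vec (Fin n) k) →
      ⟦ Graph.adj? G x y ×-dec isWalk? G y ys ⟧ * ⟦ last (y ∷ᵛ ys) Fin.≟ z ⟧
      ≡ weight x y * (⟦ isWalk? G y ys ⟧ * ⟦ last (y ∷ᵛ ys) Fin.≟ z ⟧)
    first-step y ys = trans
      (cong (_* ⟦ last (y ∷ᵛ ys) Fin.≟ z ⟧) (⟦⟧-× (Graph.adj? G x y) (isWalk? G y ys)))
      (*-assoc (weight x y) ⟦ isWalk? G y ys ⟧ ⟦ last (y ∷ᵛ ys) Fin.≟ z ⟧)

  fromℕ-closedWalkCount : ∀ k x → fromℕ (closedWalkCount G k x) ≡ adjacency^ k (indicator x) x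
  fromℕ-closedWalkCount k x = begin
    fromℕ (closedWalkCount G k x)
      ≡⟨ fromℕ-count (λ ys → isWalk? G x ys ×-dec last (x ∷ᵛ ys) Fin.≟ x) (allVecs k) ⟩
    sumOver (allVecs k) (λ ys → ⟦ isWalk? G x ys ×-dec last (x ∷ᵛ ys) Fin.≟ x ⟧)
      ≡⟨ sumOver-cong (allVecs k) (λ ys → ⟦⟧-× (isWalk? G x ys) (last (x ∷ᵛ ys) Fin.≟ x)) ⟩
    sumOver (allVecs k) (λ ys → ⟦ isWalk? G x ys ⟧ * ⟦ last (x ∷ᵛ ys) Fin.≟ x ⟧)
      ≡⟨ walk-count k x x ⟩
    adjacency^ k (indicator x) x ∎
    where open ≡-Reasoning

  adjacency-indicator : ∀ x y → adjacency (indicator x) y ≡ weight y x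
  adjacency-indicator x y = trans (⟨⟩-comm (weight y) (indicator x)) (∑-indicator x (weight y))

-- Walk-regular graphs: regularity and the balanced voltage.

module WalkRegularity {n} (G : Graph n) (connected : Connected G) (walk-regular : WalkRegular G) where
  open Network G
  open Poisson G connected
  open Walks G

  -- Walk-regularity speaks of lengths at least 2; the diagonal of A⁰ is 1, and that of A¹ is 0
  -- because there are no loops.
  diagonal-constant : ∀ k x y → adjacency^ k (indicator x) x ≡ adjacency^ k (indicator y) y
  diagonal-constant 0 x y = trans (indicator-refl x) (sym (indicator-refl y))
  diagonal-constant 1 x y = trans (loopless x) (sym (loopless y))
    where
    loopless : ∀ x → adjacency (indicator x) x ≡ 0ℚ
    loopless x = trans (adjacency-indicator x x) (weight-irrefl x)
  diagonal-constant k@(suc (suc _)) x y =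
    trans (sym (fromℕ-closedWalkCount k x))
      (trans (cong fromℕ (walk-regular k (ℕ.s≤s (ℕ.s≤s ℕ.z≤n)) x y)) (fromℕ-closedWalkCount k y))

  -- A closed walk of length 2 goes to a neighbour and back, so the diagonal of A² lists the
  -- degrees; the weights are 0 or 1 and equal their squares.
  regular : ∀ x y → degree x ≡ degree y
  regular x y = trans (sym (degree≡ x)) (trans (diagonal-constant 2 x y) (degree≡ y))
    where
    degree≡ : ∀ x → adjacency^ 2 (indicator x) x ≡ degree x
    degree≡ x = ∑-cong λ y → trans
      (cong (weight x y *_) (trans (adjacency-indicator x y) (weight-sym y x)))
      (⟦⟧-square (Graph.adj? G x y))

  module _ (a b : Fin n) where

    pairing : ℕ → (Fin n → ℚ) → ℚ
    pairing k φ = ⟨ adjacency^ k (indicator a) , φ ⟩ + ⟨ adjacency^ k (indicator b) , φ ⟩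

    -- The subspace orthogonal to 1 and to Aᵏ(e_a + e_b) for every k.
    Balanced : (Fin n → ℚ) → Set
    Balanced φ = MeanZero φ × ∀ k → pairing k φ ≡ 0ℚ

    pairing-linear : ∀ k c d (φ ψ : Fin n → ℚ) →
      pairing k (λ x → c * φ x + d * ψ x) ≡ c * pairing k φ + d * pairing k ψ
    pairing-linear k c d φ ψ = trans
      (cong₂ _+_ (⟨⟩-linearʳ (adjacency^ k (indicator a)) c d φ ψ)
                 (⟨⟩-linearʳ (adjacency^ k (indicator b)) c d φ ψ))
      (regroup c d ⟨ adjacency^ k (indicator a) , φ ⟩ ⟨ adjacency^ k (indicator a) , ψ ⟩
                   ⟨ adjacency^ k (indicator b) , φ ⟩ ⟨ adjacency^ k (indicator b) , ψ ⟩)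
      where
      regroup : ∀ c d p q r s → c * p + d * q + (c * r + d * s) ≡ c * (p + r) + d * (q + s)
      regroup = solve-∀ ring

    pairing-cong : ∀ k {φ ψ : Fin n → ℚ} → φ ≗ ψ → pairing k φ ≡ pairing k ψ
    pairing-cong k φ≗ψ = cong₂ _+_ (⟨⟩-congʳ (adjacency^ k (indicator a)) φ≗ψ)
                                   (⟨⟩-congʳ (adjacency^ k (indicator b)) φ≗ψ)

    pairing-adjacency : ∀ k (φ : Fin n → ℚ) → pairing k (adjacency φ) ≡ pairing (suc k) φ
    pairing-adjacency k φ = cong₂ _+_ (sym (adjacency-self-adjoint (adjacency^ k (indicator a)) φ))
                                      (sym (adjacency-self-adjoint (adjacency^ k (indicator b)) φ))

    vanish : ∀ c d → c * 0ℚ + d * 0ℚ ≡ 0ℚ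
    vanish = solve-∀ ring

    balanced-subspace : IsSubspace Balanced
    balanced-subspace = record
      { resp-≗      = λ φ≗ψ (∑φ≡0 , φ⊥) →
          IsSubspace.resp-≗ meanZero-subspace φ≗ψ ∑φ≡0 ,
          λ k → trans (sym (pairing-cong k φ≗ψ)) (φ⊥ k)
      ; combination = λ c d {φ} {ψ} (∑φ≡0 , φ⊥) (∑ψ≡0 , ψ⊥) →
          meanZero-combination c d {φ} {ψ} ∑φ≡0 ∑ψ≡0 ,
          λ k → trans (pairing-linear k c d φ ψ)
                  (trans (cong₂ (λ p q → c * p + d * q) (φ⊥ k) (ψ⊥ k)) (vanish c d))
      }

    -- Regularity turns the Laplacian into d I - A, so the k-th orthogonality relation for `lap φ`
    -- involves the k-th and (k + 1)-st for φ. Stability therefore needs the relations for all k at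
    -- once.
    lap-balanced : ∀ {φ : Fin n → ℚ} → Balanced φ → Balanced (lap φ)
    lap-balanced {φ} (_ , φ⊥) = ∑-lap φ , λ k → begin
      pairing k (lap φ)
        ≡⟨ pairing-cong k lap≗ ⟩
      pairing k (λ x → degree a * φ x + - 1ℚ * adjacency φ x)
        ≡⟨ pairing-linear k (degree a) (- 1ℚ) φ (adjacency φ) ⟩
      degree a * pairing k φ + - 1ℚ * pairing k (adjacency φ)
        ≡⟨ cong₂ (λ p q → degree a * p + - 1ℚ * q) (φ⊥ k) (trans (pairing-adjacency k φ) (φ⊥ (suc k))) ⟩
      degree a * 0ℚ + - 1ℚ * 0ℚ
        ≡⟨ vanish (degree a) (- 1ℚ) ⟩
      0ℚ ∎
      where
      open ≡-Reasoning
      negate : ∀ p q → p - q ≡ p + - 1ℚ * q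
      negate = solve-∀ ring
      lap≗ : ∀ x → lap φ x ≡ degree a * φ x + - 1ℚ * adjacency φ x
      lap≗ x = trans (lap-adjacency φ x)
        (trans (cong (λ d → d * φ x - adjacency φ x) (regular x a)) (negate (degree a * φ x) (adjacency φ x)))

    -- The pairing is (Aᵏ)_aa - (Aᵏ)_ab + (Aᵏ)_ba - (Aᵏ)_bb. Diagonal terms cancel by
    -- walk-regularity, off-diagonal ones by symmetry of Aᵏ. Closed walks of every length enter
    -- here.
    source-sink-balanced : Balanced (source-sink a b)
    source-sink-balanced =
        trans (∑-distrib-- (indicator a) (indicator b)) (cong₂ _-_ (∑-indicator≡1 a) (∑-indicator≡1 b))
      , λ k → begin
        pairing k (source-sink a b)
          ≡⟨ cong₂ _+_ (⟨source-sink⟩ a b (W k a)) (⟨source-sink⟩ a b (W k b)) ⟩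
        (W k a a - W k a b) + (W k b a - W k b b)
          ≡⟨ cong₂ (λ p q → (p - W k a b) + (q - W k b b)) (diagonal-constant k a b) (walks-sym k a b) ⟩
        (W k b b - W k a b) + (W k a b - W k b b)
          ≡⟨ cancel (W k b b) (W k a b) ⟩
        0ℚ ∎
      where
      open ≡-Reasoning
      W : ℕ → Fin n → Fin n → ℚ
      W k x = adjacency^ k (indicator x)
      cancel : ∀ p q → (p - q) + (q - p) ≡ 0ℚ
      cancel = solve-∀ ring

    balanced-voltage : ∃[ v ] (lap v ≗ source-sink a b × MeanZero v × v a + v b ≡ 0ℚ)
    balanced-voltage =
      let v , (∑v≡0 , v⊥) , lap-v = Krylov.solvable lap-linear balanced-subspace lap-balanced
            (λ (∑φ≡0 , _) → lap-injective ∑φ≡0) source-sink-balanced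
      -- The relation for k = 0 is orthogonality to e_a + e_b itself.
      in v , lap-v , ∑v≡0 , trans (sym (cong₂ _+_ (∑-indicator a v) (∑-indicator b v))) (v⊥ 0)

-- Convergence

∣p∣≤q : ∀ {p q} → p ≤ q → - p ≤ q → ∣ p ∣ ≤ q
∣p∣≤q {p} {q} p≤q -p≤q with ∣p∣≡p∨∣p∣≡-p p
... | inj₁ eq = subst (_≤ q) (sym eq) p≤q
... | inj₂ eq = subst (_≤ q) (sym eq) -p≤q

-- For m ≥ D / ε and N > m, N t_N ≤ D ≤ m ε < N ε. Starting at m + 1 supplies the strict inequality.
null-sequence : ∀ {t : ℕ → ℚ} {D} → (∀ N → fromℕ N * t N ≤ D) →
                ∀ ε → 0ℚ < ε → ∃[ M ] (∀ N → M ℕ.≤ N → t N < ε)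
null-sequence {t} {D} bound ε 0<ε = suc m , λ N m<N →
  *-cancelˡ-<-nonNeg (fromℕ N) {{nonNegative (fromℕ-nonNeg N)}} (begin-strict
    fromℕ N * t N        ≤⟨ bound N ⟩
    D                    ≡⟨ D≡ ⟩
    D * 1/ ε * ε         ≤⟨ *-monoʳ-≤ ε (<⇒≤ 0<ε) D/ε≤m ⟩
    fromℕ m * ε          <⟨ *-monoˡ-<-pos ε {{positive 0<ε}} (m<1+m m) ⟩
    fromℕ (suc m) * ε    ≤⟨ *-monoʳ-≤ ε (<⇒≤ 0<ε) (fromℕ-mono m<N) ⟩
    fromℕ N * ε          ∎)
  where
  open ≤-Reasoning
  instance
    ε≢0 : NonZero ε
    ε≢0 = pos⇒nonZero ε {{positive 0<ε}}
  m = proj₁ (archimedean (D * 1/ ε))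
  D/ε≤m = proj₂ (archimedean (D * 1/ ε))
  D≡ : D ≡ D * 1/ ε * ε
  D≡ = sym (trans (*-assoc D (1/ ε) ε) (trans (cong (D *_) (*-inverseˡ ε)) (*-identityʳ D)))
  m<1+m : ∀ m → fromℕ m < fromℕ (suc m)
  m<1+m m = subst₂ _<_ (+-identityˡ (fromℕ m)) (sym (fromℕ-suc m)) (+-monoˡ-< (fromℕ m) (positive⁻¹ 1ℚ))

-- Grows at the last index, as inductions on N require, whereas the fold over `upTo` unfolds at the
-- first; index N is excluded.
partialSum : (ℕ → ℚ) → ℕ → ℚ
partialSum t zero    = 0ℚ
partialSum t (suc N) = partialSum t N + t N

sumOver-upTo-suc : ∀ N (t : ℕ → ℚ) → sumOver (upTo (suc N)) t ≡ sumOver (upTo N) t + t N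
sumOver-upTo-suc N t = begin
  sumOver (upTo (suc N)) t         ≡⟨ cong (λ ks → sumOver ks t) (upTo-∷ʳ N) ⟨
  sumOver (upTo N ++ N ∷ []) t     ≡⟨ sumOver-++ (upTo N) (N ∷ []) t ⟩
  sumOver (upTo N) t + (t N + 0ℚ)  ≡⟨ cong (sumOver (upTo N) t +_) (+-identityʳ (t N)) ⟩
  sumOver (upTo N) t + t N         ∎
  where open ≡-Reasoning

-- The error is indexed by the last summand, since the sums through time N have closed forms in s_N.
-- The threshold `suc M` shifts back and rules out the empty sum.
hasSum : ∀ {t e : ℕ → ℚ} {l} → (∀ N → ∣ sumOver (upTo (suc N)) t - l ∣ ≤ e N) →
         (∀ ε → 0ℚ < ε → ∃[ M ] (∀ N → M ℕ.≤ N → e N < ε)) → HasSum t l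
hasSum error≤e e→0 ε 0<ε =
  let M , e<ε = e→0 ε 0<ε
  in suc M , λ where (suc N) (ℕ.s≤s M≤N) → ≤-<-trans (error≤e N) (e<ε N M≤N)

-- Summation by parts bounds Σ (k + 1) s_k by the remainders, hence by Σ s_k, and
-- monotonicity then gives s_N = O(1/N²), so that N s_N → 0.
module Decay (s : ℕ → ℚ) (f C : ℚ)
  (s-nonNeg : ∀ k → 0ℚ ≤ s k) (s-antitone : ∀ k → s (suc k) ≤ s k) (s₀≤1 : s 0 ≤ 1ℚ)
  (0≤C : 0ℚ ≤ C)
  (remainder≤  : ∀ N → f - partialSum s N ≤ C * s N)
  (-remainder≤ : ∀ N → - (f - partialSum s N) ≤ C * s N) where

  S = partialSum s

  r : ℕ → ℚ
  r N = f - S N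

  s≤1 : ∀ k → s k ≤ 1ℚ
  s≤1 zero    = s₀≤1
  s≤1 (suc k) = ≤-trans (s-antitone k) (s≤1 k)

  C*s≤C : ∀ k → C * s k ≤ C
  C*s≤C k = subst (C * s k ≤_) (*-identityʳ C) (*-monoˡ-≤ C 0≤C (s≤1 k))

  -- S_N is the difference of the remainders at 0 and at N, and each is at most C in absolute value.
  S≤2C : ∀ N → S N ≤ C + C
  S≤2C N = subst (_≤ C + C) (eq f (S N)) (+-mono-≤ (≤-trans (remainder≤ 0) (C*s≤C 0))
                                                   (≤-trans (-remainder≤ N) (C*s≤C N)))
    where
    eq : ∀ f S → f - 0ℚ + - (f - S) ≡ S
    eq = solve-∀ ring

  -- By monotonicity s_N is at most each of the N terms of S_N.
  N*s≤S : ∀ N → fromℕ N * s N ≤ S N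
  N*s≤S zero    = ≤-reflexive (*-zeroˡ (s 0))
  N*s≤S (suc N) = begin
    fromℕ (suc N) * s (suc N)    ≤⟨ *-monoˡ-≤ (fromℕ (suc N)) (fromℕ-nonNeg (suc N)) (s-antitone N) ⟩
    fromℕ (suc N) * s N          ≡⟨ cong (_* s N) (fromℕ-suc N) ⟩
    (1ℚ + fromℕ N) * s N         ≡⟨ eq (fromℕ N) (s N) ⟩
    fromℕ N * s N + s N          ≤⟨ +-monoˡ-≤ (s N) (N*s≤S N) ⟩
    S N + s N                    ∎
    where
    open ≤-Reasoning
    eq : ∀ m p → (1ℚ + m) * p ≡ m * p + p
    eq = solve-∀ ring

  N*s≤2C : ∀ N → fromℕ N * s N ≤ C + C
  N*s≤2C N = ≤-trans (N*s≤S N) (S≤2C N)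

  T : ℕ → ℚ
  T = partialSum (λ k → fromℕ (suc k) * s k)

  -- Abel summation, with s_k written as r_k - r_{k+1}.
  T≡ : ∀ N → T N ≡ partialSum r N - fromℕ N * r N
  T≡ zero    = sym (cong (λ p → 0ℚ - p) (*-zeroˡ (r 0)))
  T≡ (suc N) = begin
    T N + fromℕ (suc N) * s N
      ≡⟨ cong₂ (λ p m → p + m * s N) (T≡ N) (fromℕ-suc N) ⟩
    partialSum r N - fromℕ N * (f - S N) + (1ℚ + fromℕ N) * s N
      ≡⟨ eq (partialSum r N) (fromℕ N) f (S N) (s N) ⟩
    partialSum r N + (f - S N) - (1ℚ + fromℕ N) * (f - (S N + s N))
      ≡⟨ cong (λ m → partialSum r N + r N - m * r (suc N)) (fromℕ-suc N) ⟨
    partialSum r N + r N - fromℕ (suc N) * r (suc N) ∎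
    where
    open ≡-Reasoning
    eq : ∀ R m f S s → R - m * (f - S) + (1ℚ + m) * s ≡ R + (f - S) - (1ℚ + m) * (f - (S + s))
    eq = solve-∀ ring

  partialSum-r≤ : ∀ N → partialSum r N ≤ C * S N
  partialSum-r≤ zero    = ≤-reflexive (sym (*-zeroʳ C))
  partialSum-r≤ (suc N) = subst (partialSum r (suc N) ≤_) (sym (*-distribˡ-+ C (S N) (s N)))
                                (+-mono-≤ (partialSum-r≤ N) (remainder≤ N))

  -- One half bounds C S_N, the other C (N s_N); both use the bound C + C.
  B = C * (C + C) + C * (C + C)

  T≤B : ∀ N → T N ≤ B
  T≤B N = begin
    T N                                    ≡⟨ T≡ N ⟩
    partialSum r N - fromℕ N * r N         ≡⟨ cong (partialSum r N +_) (neg-distribʳ-* (fromℕ N) (r N)) ⟩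
    partialSum r N + fromℕ N * - r N
      ≤⟨ +-mono-≤ (partialSum-r≤ N) (*-monoˡ-≤ (fromℕ N) (fromℕ-nonNeg N) (-remainder≤ N)) ⟩
    C * S N + fromℕ N * (C * s N)          ≡⟨ cong (C * S N +_) (eq (fromℕ N) C (s N)) ⟩
    C * S N + C * (fromℕ N * s N)          ≤⟨ +-mono-≤ (*-monoˡ-≤ C 0≤C (S≤2C N)) (*-monoˡ-≤ C 0≤C (N*s≤2C N)) ⟩
    B                                      ∎
    where
    open ≤-Reasoning
    eq : ∀ m c p → m * (c * p) ≡ c * (m * p)
    eq = solve-∀ ring

  -- By monotonicity T_N is at least s_N (1 + ... + N), which is at least N² s_N / 2; doubling
  -- avoids the fraction. In the induction step (N + 1)² = N² + 2 (N + 1) - 1, and the term - s_N is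
  -- dropped.
  N*N*s≤2T : ∀ N → fromℕ N * (fromℕ N * s N) ≤ T N + T N
  N*N*s≤2T zero    = ≤-reflexive (*-zeroˡ (0ℚ * s 0))
  N*N*s≤2T (suc N) = begin
    fromℕ (suc N) * (fromℕ (suc N) * s (suc N))
      ≤⟨ *-monoˡ-≤ m⁺ 0≤m⁺ (*-monoˡ-≤ m⁺ 0≤m⁺ (s-antitone N)) ⟩
    fromℕ (suc N) * (fromℕ (suc N) * s N)
      ≡⟨ cong (λ m → m * (m * s N)) (fromℕ-suc N) ⟩
    (1ℚ + fromℕ N) * ((1ℚ + fromℕ N) * s N)
      ≡⟨ eq (fromℕ N) (s N) ⟩
    fromℕ N * (fromℕ N * s N) + ((1ℚ + fromℕ N) * s N + (1ℚ + fromℕ N) * s N) - s N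
      ≤⟨ +-mono-≤ (+-monoˡ-≤ _ (N*N*s≤2T N)) (neg-antimono-≤ (s-nonNeg N)) ⟩
    T N + T N + ((1ℚ + fromℕ N) * s N + (1ℚ + fromℕ N) * s N) - 0ℚ
      ≡⟨ eq′ (T N) ((1ℚ + fromℕ N) * s N) ⟩
    (T N + (1ℚ + fromℕ N) * s N) + (T N + (1ℚ + fromℕ N) * s N)
      ≡⟨ cong (λ m → (T N + m * s N) + (T N + m * s N)) (fromℕ-suc N) ⟨
    T (suc N) + T (suc N) ∎
    where
    open ≤-Reasoning
    m⁺ = fromℕ (suc N)
    0≤m⁺ = fromℕ-nonNeg (suc N)
    eq : ∀ m p → (1ℚ + m) * ((1ℚ + m) * p) ≡ m * (m * p) + ((1ℚ + m) * p + (1ℚ + m) * p) - p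
    eq = solve-∀ ring
    eq′ : ∀ t p → t + t + (p + p) - 0ℚ ≡ (t + p) + (t + p)
    eq′ = solve-∀ ring

  s→0 : ∀ ε → 0ℚ < ε → ∃[ M ] (∀ N → M ℕ.≤ N → s N < ε)
  s→0 = null-sequence N*s≤2C

  -- The mean truncated at time N is S_N - N s_N, so it misses f by at most |r_N| + N s_N, where
  -- |r_N| ≤ C s_N.
  error : ℕ → ℚ
  error N = C * s N + fromℕ N * s N

  error→0 : ∀ ε → 0ℚ < ε → ∃[ M ] (∀ N → M ℕ.≤ N → error N < ε)
  error→0 = null-sequence {error} {C * (C + C) + (B + B)} λ N → begin
    fromℕ N * (C * s N + fromℕ N * s N)             ≡⟨ eq (fromℕ N) C (s N) ⟩
    C * (fromℕ N * s N) + fromℕ N * (fromℕ N * s N)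
      ≤⟨ +-mono-≤ (*-monoˡ-≤ C 0≤C (N*s≤2C N)) (≤-trans (N*N*s≤2T N) (+-mono-≤ (T≤B N) (T≤B N))) ⟩
    C * (C + C) + (B + B)                           ∎
    where
    open ≤-Reasoning
    eq : ∀ m c p → m * (c * p + m * p) ≡ c * (m * p) + m * (m * p)
    eq = solve-∀ ring

  r-antitone : ∀ k d → r (d ℕ.+ k) ≤ r k
  r-antitone k zero    = ≤-refl
  r-antitone k (suc d) = ≤-trans (subst₂ _≤_ (eq f (S (d ℕ.+ k)) (s (d ℕ.+ k))) (+-identityʳ (r (d ℕ.+ k)))
      (+-monoʳ-≤ (r (d ℕ.+ k)) (neg-antimono-≤ (s-nonNeg (d ℕ.+ k))))) (r-antitone k d)
    where
    eq : ∀ f S s → f - S - s ≡ f - (S + s)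
    eq = solve-∀ ring

  -- The remainder is antitone and bounded below by - `error`, which tends to 0, so it cannot become
  -- negative. The case k = 2 later gives the strict bound 1 < f.
  S≤f : ∀ k → S k ≤ f
  S≤f k = 0≤q-p⇒p≤q (≮⇒≥ λ r<0 →
    let -r = - r k
        M , error<-r = error→0 -r (neg-antimono-< r<0)
        N = M ℕ.+ k
        Cs≤error : C * s N ≤ error N
        Cs≤error = subst (_≤ error N) (+-identityʳ (C * s N))
          (+-monoʳ-≤ (C * s N) (*-nonNeg (fromℕ-nonNeg N) (s-nonNeg N)))
    in <-irrefl refl (≤-<-trans
         (≤-trans (neg-antimono-≤ (r-antitone k M)) (≤-trans (-remainder≤ N) Cs≤error))
         (error<-r N (ℕ.m≤m+n M k))))

  module _ (p : ℕ → ℚ) (p₀≡ : p 0 ≡ 1ℚ - s 0) (p-suc≡ : ∀ j → p (suc j) ≡ s j - s (suc j)) where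

    sum-p : ∀ N → sumOver (upTo (suc N)) p ≡ 1ℚ - s N
    sum-p zero    = trans (+-identityʳ (p 0)) p₀≡
    sum-p (suc N) = begin
      sumOver (upTo (suc (suc N))) p          ≡⟨ sumOver-upTo-suc (suc N) p ⟩
      sumOver (upTo (suc N)) p + p (suc N)    ≡⟨ cong₂ _+_ (sum-p N) (p-suc≡ N) ⟩
      1ℚ - s N + (s N - s (suc N))            ≡⟨ eq (s N) (s (suc N)) ⟩
      1ℚ - s (suc N)                          ∎
      where
      open ≡-Reasoning
      eq : ∀ p q → 1ℚ - p + (p - q) ≡ 1ℚ - q
      eq = solve-∀ ring

    -- Summation by parts for a time with law p and tails s_j = P(T > j): the mean truncated at N is
    -- the sum of the first N tails less N s_N.
    sum-jp : ∀ N → sumOver (upTo (suc N)) (λ j → fromℕ j * p j) ≡ S N - fromℕ N * s N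
    sum-jp zero    = trans (+-identityʳ (0ℚ * p 0)) (trans (*-zeroˡ (p 0)) (sym (cong (λ q → 0ℚ - q) (*-zeroˡ (s 0)))))
    sum-jp (suc N) = begin
      sumOver (upTo (suc (suc N))) (λ j → fromℕ j * p j)
        ≡⟨ sumOver-upTo-suc (suc N) (λ j → fromℕ j * p j) ⟩
      sumOver (upTo (suc N)) (λ j → fromℕ j * p j) + fromℕ (suc N) * p (suc N)
        ≡⟨ cong₂ _+_ (sum-jp N) (cong₂ _*_ (fromℕ-suc N) (p-suc≡ N)) ⟩
      S N - fromℕ N * s N + (1ℚ + fromℕ N) * (s N - s (suc N))
        ≡⟨ eq (S N) (fromℕ N) (s N) (s (suc N)) ⟩
      S N + s N - (1ℚ + fromℕ N) * s (suc N)
        ≡⟨ cong (λ m → S N + s N - m * s (suc N)) (fromℕ-suc N) ⟨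
      S (suc N) - fromℕ (suc N) * s (suc N) ∎
      where
      open ≡-Reasoning
      eq : ∀ S m p q → S - m * p + (1ℚ + m) * (p - q) ≡ S + p - (1ℚ + m) * q
      eq = solve-∀ ring

    total-probability : HasSum p 1ℚ
    total-probability = hasSum {p} {s} {1ℚ} (λ N → ≤-reflexive (begin
      ∣ sumOver (upTo (suc N)) p - 1ℚ ∣  ≡⟨ cong (λ q → ∣ q - 1ℚ ∣) (sum-p N) ⟩
      ∣ 1ℚ - s N - 1ℚ ∣                  ≡⟨ cong ∣_∣ (eq (s N)) ⟩
      ∣ - s N ∣                          ≡⟨ ∣-p∣≡∣p∣ (s N) ⟩
      ∣ s N ∣                            ≡⟨ 0≤p⇒∣p∣≡p (s-nonNeg N) ⟩
      s N                                ∎)) s→0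
      where
      open ≡-Reasoning
      eq : ∀ p → 1ℚ - p - 1ℚ ≡ - p
      eq = solve-∀ ring

    expectation : HasSum (λ j → fromℕ j * p j) f
    expectation = hasSum {λ j → fromℕ j * p j} {error} (λ N → begin
      ∣ sumOver (upTo (suc N)) (λ j → fromℕ j * p j) - f ∣  ≡⟨ cong (λ q → ∣ q - f ∣) (sum-jp N) ⟩
      ∣ S N - fromℕ N * s N - f ∣                           ≡⟨ cong ∣_∣ (eq (S N) (fromℕ N * s N) f) ⟩
      ∣ - (r N) - fromℕ N * s N ∣                           ≤⟨ ∣p-q∣≤∣p∣+∣q∣ (- r N) (fromℕ N * s N) ⟩
      ∣ - (r N) ∣ + ∣ fromℕ N * s N ∣
        ≤⟨ +-mono-≤ (subst (_≤ C * s N) (sym (∣-p∣≡∣p∣ (r N))) (∣p∣≤q (remainder≤ N) (-remainder≤ N)))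
                    (≤-reflexive (0≤p⇒∣p∣≡p (*-nonNeg (fromℕ-nonNeg N) (s-nonNeg N)))) ⟩
      error N ∎) error→0
      where
      open ≤-Reasoning
      eq : ∀ S q f → S - q - f ≡ - (f - S) - q
      eq = solve-∀ ring

-- Hitting times of b: the killed walk and the first-step equations.

module HittingTime {n} (G : Graph n) (connected : Connected G) (b : Fin n) where
  open Network G
  open Poisson G connected

  outside : Fin n → ℚ
  outside x = 1ℚ - indicator b x

  outside-≢ : ∀ {x} → x ≢ b → outside x ≡ 1ℚ
  outside-≢ x≢b = cong (λ p → 1ℚ - p) (indicator-≢ x≢b)

  outside-nonNeg : ∀ x → 0ℚ ≤ outside x
  outside-nonNeg x with x Fin.≟ b
  ... | yes _ = ≤-refl
  ... | no  _ = nonNegative⁻¹ 1ℚ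

  outside≤1 : ∀ x → outside x ≤ 1ℚ
  outside≤1 x with x Fin.≟ b
  ... | yes _ = nonNegative⁻¹ 1ℚ
  ... | no  _ = ≤-refl

  -- The walk killed on reaching b.
  step : (Fin n → ℚ) → Fin n → ℚ
  step φ x = outside x * ∑ (λ y → transition G x y * φ y)

  transition≡ : ∀ x y → transition G x y ≡ reciprocal (deg G x) * weight x y
  transition≡ x y with Graph.adj? G x y
  ... | yes _ = sym (*-identityʳ (reciprocal (deg G x)))
  ... | no  _ = sym (*-zeroʳ (reciprocal (deg G x)))

  transition-nonNeg : ∀ x y → 0ℚ ≤ transition G x y
  transition-nonNeg x y = subst (0ℚ ≤_) (sym (transition≡ x y))
    (*-nonNeg (reciprocal-nonNeg (deg G x)) (⟦⟧-nonNeg (Graph.adj? G x y)))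

  adj⇒reciprocal-inverse : ∀ {x y} → Adj G x y → reciprocal (deg G x) * degree x ≡ 1ℚ
  adj⇒reciprocal-inverse {x} {y} adj with deg G x | fromℕ-deg x
  ... | suc m | eq = trans (cong (reciprocal (suc m) *_) (sym eq)) (reciprocal-inverse m)
  ... | zero  | eq = contradiction (<-≤-trans (positive⁻¹ 1ℚ) 1≤0) (<-irrefl refl)
    where
    1≤0 : 1ℚ ≤ 0ℚ
    1≤0 = subst₂ _≤_ (⟦⟧-true (Graph.adj? G x y) adj) (sym eq)
            (term≤∑ {f = weight x} (λ z → ⟦⟧-nonNeg (Graph.adj? G x z)) y)

  -- A path from x to b cannot be empty, so x has a neighbour and positive degree.
  ≢⇒reciprocal-inverse : ∀ {x} → x ≢ b → reciprocal (deg G x) * degree x ≡ 1ℚ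
  ≢⇒reciprocal-inverse {x} x≢b with connected x b
  ... | Star.ε      = contradiction refl x≢b
  ... | adj ◅ _ = adj⇒reciprocal-inverse adj

  ∑-transition : ∀ x (φ : Fin n → ℚ) →
    ∑ (λ y → transition G x y * φ y) ≡ reciprocal (deg G x) * adjacency φ x
  ∑-transition x φ = trans
    (∑-cong λ y → trans (cong (_* φ y) (transition≡ x y)) (*-assoc (reciprocal (deg G x)) (weight x y) (φ y)))
    (∑-*ˡ (reciprocal (deg G x)) (λ y → weight x y * φ y))

  step-linear : ∀ c d (φ ψ : Fin n → ℚ) x → step (λ y → c * φ y + d * ψ y) x ≡ c * step φ x + d * step ψ x
  step-linear c d φ ψ x = trans (cong (outside x *_) (⟨⟩-linearʳ (transition G x) c d φ ψ))
    (expand (outside x) c d (⟨ transition G x , φ ⟩) (⟨ transition G x , ψ ⟩))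
    where
    expand : ∀ o c d p q → o * (c * p + d * q) ≡ c * (o * p) + d * (o * q)
    expand = solve-∀ ring

  step-cong : ∀ {φ ψ : Fin n → ℚ} → φ ≗ ψ → step φ ≗ step ψ
  step-cong φ≗ψ x = cong (outside x *_) (⟨⟩-congʳ (transition G x) φ≗ψ)

  step-sub : ∀ (φ ψ : Fin n → ℚ) x → step (λ y → φ y - ψ y) x ≡ step φ x - step ψ x
  step-sub φ ψ x = trans (cong (outside x *_) (⟨⟩-subʳ (transition G x) φ ψ))
    (expand (outside x) (⟨ transition G x , φ ⟩) (⟨ transition G x , ψ ⟩))
    where
    expand : ∀ o p q → o * (p - q) ≡ o * p - o * q
    expand = solve-∀ ring

  step-mono : ∀ {φ ψ : Fin n → ℚ} → (∀ x → φ x ≤ ψ x) → ∀ x → step φ x ≤ step ψ x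
  step-mono φ≤ψ x = *-monoˡ-≤ (outside x) (outside-nonNeg x)
    (∑-mono λ y → *-monoˡ-≤ (transition G x y) (transition-nonNeg x y) (φ≤ψ y))

  step-scale : ∀ c (φ : Fin n → ℚ) x → step (λ y → c * φ y) x ≡ c * step φ x
  step-scale c φ x = trans (step-cong (λ y → pad c (φ y)) x)
    (trans (step-linear c 0ℚ φ φ x) (sym (pad c (step φ x))))
    where
    pad : ∀ c p → c * p ≡ c * p + 0ℚ * p
    pad = solve-∀ ring

  step-neg : ∀ (φ : Fin n → ℚ) x → step (λ y → - φ y) x ≡ - step φ x
  step-neg φ x = trans (step-cong (λ y → neg≡ (φ y)) x) (trans (step-scale (- 1ℚ) φ x) (sym (neg≡ (step φ x))))
    where
    neg≡ : ∀ p → - p ≡ - 1ℚ * p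
    neg≡ = solve-∀ ring

  step-outside : ∀ x → step (const 1ℚ) x ≡ outside x
  step-outside x with x Fin.≟ b
  ... | yes _   = *-zeroˡ (∑ (λ y → transition G x y * 1ℚ))
  ... | no  x≢b = begin
    1ℚ * ∑ (λ y → transition G x y * 1ℚ)            ≡⟨ *-identityˡ _ ⟩
    ∑ (λ y → transition G x y * 1ℚ)                 ≡⟨ ∑-transition x (const 1ℚ) ⟩
    reciprocal (deg G x) * adjacency (const 1ℚ) x
      ≡⟨ cong (reciprocal (deg G x) *_) (∑-cong λ y → *-identityʳ (weight x y)) ⟩
    reciprocal (deg G x) * degree x                 ≡⟨ ≢⇒reciprocal-inverse x≢b ⟩
    1ℚ                                              ∎
    where open ≡-Reasoning

  -- This is P_x(T_b > k): the mass of the killed walk after k steps.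
  survival : ℕ → Fin n → ℚ
  survival zero    = outside
  survival (suc k) = step (survival k)

  survival-nonNeg : ∀ k x → 0ℚ ≤ survival k x
  survival-nonNeg zero    x = outside-nonNeg x
  survival-nonNeg (suc k) x = *-nonNeg (outside-nonNeg x)
    (∑-nonNeg λ y → *-nonNeg (transition-nonNeg x y) (survival-nonNeg k y))

  survival-antitone : ∀ k x → survival (suc k) x ≤ survival k x
  survival-antitone zero    x = subst (step outside x ≤_) (step-outside x) (step-mono outside≤1 x)
  survival-antitone (suc k) x = step-mono (survival-antitone k) x

  FirstHit⇒ : ∀ {k x y} {ys : Vec (Fin n) k} →
              FirstHitAtEnd b x (y ∷ᵛ ys) → x ≢ b × FirstHitAtEnd b y ys
  FirstHit⇒ (end , x≢b All.∷ rest) = x≢b , end , rest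

  FirstHit⇐ : ∀ {k x y} {ys : Vec (Fin n) k} →
              x ≢ b × FirstHitAtEnd b y ys → FirstHitAtEnd b x (y ∷ᵛ ys)
  FirstHit⇐ (x≢b , end , rest) = end , x≢b All.∷ rest

  hittingProb-filter : ∀ x j → hittingProb G x b j
    ≡ sumOver (allVecs j) (λ ys → ⟦ firstHitAtEnd? b x ys ⟧ * trajectoryProb G x ys)
  hittingProb-filter x j = sumOver-filter (firstHitAtEnd? b x) (allVecs j) (trajectoryProb G x)

  hittingProb-zero : ∀ x → hittingProb G x b 0 ≡ indicator b x
  hittingProb-zero x = begin
    hittingProb G x b 0
      ≡⟨ hittingProb-filter x 0 ⟩
    ⟦ firstHitAtEnd? b x []ᵛ ⟧ * 1ℚ + 0ℚ
      ≡⟨ trans (+-identityʳ _) (*-identityʳ _) ⟩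
    ⟦ firstHitAtEnd? b x []ᵛ ⟧
      ≡⟨ ⟦⟧-cong (firstHitAtEnd? b x []ᵛ) (x Fin.≟ b) proj₁ (λ x≡b → x≡b , All.[]) ⟩
    ⟦ x Fin.≟ b ⟧
      ≡⟨ indicator≡⟦⟧ b x ⟨
    indicator b x ∎
    where open ≡-Reasoning

  -- Conditioning on the first step. The vertices that must avoid b include the starting one, whence
  -- the factor `outside x`.
  hittingProb-suc : ∀ x j → hittingProb G x b (suc j) ≡ step (λ y → hittingProb G y b j) x
  hittingProb-suc x j = begin
    hittingProb G x b (suc j)
      ≡⟨ hittingProb-filter x (suc j) ⟩
    sumOver (allVecs (suc j)) (λ ys → ⟦ firstHitAtEnd? b x ys ⟧ * trajectoryProb G x ys)
      ≡⟨ sumOver-cartesianProductWith _∷ᵛ_ (allFin n) (allVecs j) _ ⟩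
    sumOver (allFin n) (λ y → sumOver (allVecs j) (λ ys →
      ⟦ firstHitAtEnd? b x (y ∷ᵛ ys) ⟧ * (transition G x y * trajectoryProb G y ys)))
      ≡⟨ sumOver-allFin {n} _ ⟩
    ∑ (λ y → sumOver (allVecs j) (λ ys →
      ⟦ firstHitAtEnd? b x (y ∷ᵛ ys) ⟧ * (transition G x y * trajectoryProb G y ys)))
      ≡⟨ ∑-cong (λ y → trans (sumOver-cong (allVecs j) (first-step y)) (sumOver-*ˡ (allVecs j) (outside x * transition G x y) _)) ⟩
    ∑ (λ y → outside x * transition G x y *
             sumOver (allVecs j) (λ ys → ⟦ firstHitAtEnd? b y ys ⟧ * trajectoryProb G y ys))
      ≡⟨ ∑-cong (λ y → trans (cong (outside x * transition G x y *_) (sym (hittingProb-filter y j)))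
                             (*-assoc (outside x) (transition G x y) (hittingProb G y b j))) ⟩
    ∑ (λ y → outside x * (transition G x y * hittingProb G y b j))
      ≡⟨ ∑-*ˡ (outside x) (λ y → transition G x y * hittingProb G y b j) ⟩
    step (λ y → hittingProb G y b j) x ∎
    where
    open ≡-Reasoning
    regroup : ∀ o h t p → o * h * (t * p) ≡ o * t * (h * p)
    regroup = solve-∀ ring
    first-step : ∀ y (ys : Vec (Fin n) j) →
      ⟦ firstHitAtEnd? b x (y ∷ᵛ ys) ⟧ * (transition G x y * trajectoryProb G y ys)
      ≡ outside x * transition G x y * (⟦ firstHitAtEnd? b y ys ⟧ * trajectoryProb G y ys)
    first-step y ys = begin
      ⟦ firstHitAtEnd? b x (y ∷ᵛ ys) ⟧ * (transition G x y * trajectoryProb G y ys)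
        ≡⟨ cong (_* _) (⟦⟧-cong (firstHitAtEnd? b x (y ∷ᵛ ys)) (¬? (x Fin.≟ b) ×-dec firstHitAtEnd? b y ys)
                                FirstHit⇒ FirstHit⇐) ⟩
      ⟦ ¬? (x Fin.≟ b) ×-dec firstHitAtEnd? b y ys ⟧ * (transition G x y * trajectoryProb G y ys)
        ≡⟨ cong (_* _) (⟦⟧-× (¬? (x Fin.≟ b)) (firstHitAtEnd? b y ys)) ⟩
      ⟦ ¬? (x Fin.≟ b) ⟧ * ⟦ firstHitAtEnd? b y ys ⟧ * (transition G x y * trajectoryProb G y ys)
        ≡⟨ cong (λ o → o * ⟦ firstHitAtEnd? b y ys ⟧ * (transition G x y * trajectoryProb G y ys)) outside≡ ⟩
      outside x * ⟦ firstHitAtEnd? b y ys ⟧ * (transition G x y * trajectoryProb G y ys)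
        ≡⟨ regroup (outside x) ⟦ firstHitAtEnd? b y ys ⟧ (transition G x y) (trajectoryProb G y ys) ⟩
      outside x * transition G x y * (⟦ firstHitAtEnd? b y ys ⟧ * trajectoryProb G y ys) ∎
      where
      outside≡ : ⟦ ¬? (x Fin.≟ b) ⟧ ≡ outside x
      outside≡ = trans (⟦⟧-¬ (x Fin.≟ b)) (cong (λ p → 1ℚ - p) (sym (indicator≡⟦⟧ b x)))

  hittingProb-zero-survival : ∀ x → hittingProb G x b 0 ≡ 1ℚ - survival 0 x
  hittingProb-zero-survival x = trans (hittingProb-zero x) (complement (indicator b x))
    where
    complement : ∀ p → p ≡ 1ℚ - (1ℚ - p)
    complement = solve-∀ ring

  -- Both sides obey the same recursion under `step`. At time 1 it rests on the fact that a step
  -- from any vertex other than b preserves total mass (`step-outside`).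
  hittingProb-suc-survival : ∀ j x → hittingProb G x b (suc j) ≡ survival j x - survival (suc j) x
  hittingProb-suc-survival zero    x = begin
    hittingProb G x b 1                      ≡⟨ hittingProb-suc x 0 ⟩
    step (λ y → hittingProb G y b 0) x       ≡⟨ step-cong hittingProb-zero-survival x ⟩
    step (λ y → 1ℚ - survival 0 y) x         ≡⟨ step-sub (const 1ℚ) (survival 0) x ⟩
    step (const 1ℚ) x - survival 1 x         ≡⟨ cong (_- survival 1 x) (step-outside x) ⟩
    survival 0 x - survival 1 x              ∎
    where open ≡-Reasoning
  hittingProb-suc-survival (suc j) x = begin
    hittingProb G x b (suc (suc j))                ≡⟨ hittingProb-suc x (suc j) ⟩
    step (λ y → hittingProb G y b (suc j)) x       ≡⟨ step-cong (hittingProb-suc-survival j) x ⟩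
    step (λ y → survival j y - survival (suc j) y) x ≡⟨ step-sub (survival j) (survival (suc j)) x ⟩
    survival (suc j) x - survival (suc (suc j)) x  ∎
    where open ≡-Reasoning

  ∑-deficit : ∑ (λ x → degree x - totalDegree * indicator b x) ≡ 0ℚ
  ∑-deficit = begin
    ∑ (λ x → degree x - totalDegree * indicator b x)
      ≡⟨ ∑-distrib-- degree (λ x → totalDegree * indicator b x) ⟩
    totalDegree - ∑ (λ x → totalDegree * indicator b x)
      ≡⟨ cong (λ p → totalDegree - p) (trans (∑-*ˡ totalDegree (indicator b)) (cong (totalDegree *_) (∑-indicator≡1 b))) ⟩
    totalDegree - totalDegree * 1ℚ
      ≡⟨ cancel totalDegree ⟩
    0ℚ ∎
    where
    open ≡-Reasoning
    cancel : ∀ p → p - p * 1ℚ ≡ 0ℚ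
    cancel = solve-∀ ring

  -- Off b the equation is the first-step relation f x = 1 + Σ P(x , y) f y multiplied by the
  -- degree. Its value at b is forced, as a Laplacian sums to 0 (`∑-deficit`), and a shift by a
  -- constant arranges f b = 0. That f is the expected hitting time is proved afterwards.
  hitting-potential : ∃[ f ] (f b ≡ 0ℚ × ∀ x → lap f x ≡ degree x - totalDegree * indicator b x)
  hitting-potential =
    let w , lap-w = lap-surjective ∑-deficit
    in (λ x → w x - w b) , +-inverseʳ (w b) ,
       λ x → trans (∑-cong λ y → cong (weight x y *_) (shift (w x) (w y) (w b))) (lap-w x)
    where
    shift : ∀ p q r → p - r - (q - r) ≡ p - q
    shift = solve-∀ ring

  potential-pairing : ∀ {a} {f v : Fin n → ℚ} →
    f b ≡ 0ℚ → (∀ x → lap f x ≡ degree x - totalDegree * indicator b x) →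
    lap v ≗ source-sink a b → f a ≡ ⟨ v , degree ⟩ - totalDegree * v b
  potential-pairing {a} {f} {v} fb≡0 lap-f lap-v = begin
    f a                              ≡⟨ pad (f a) ⟩
    f a - 0ℚ                         ≡⟨ cong (λ p → f a - p) fb≡0 ⟨
    f a - f b                        ≡⟨ ⟨source-sink⟩ a b f ⟨
    ⟨ f , source-sink a b ⟩          ≡⟨ ⟨⟩-congʳ f lap-v ⟨
    ⟨ f , lap v ⟩                    ≡⟨ lap-self-adjoint v f ⟩
    ⟨ v , lap f ⟩                    ≡⟨ ⟨⟩-congʳ v lap-f ⟩
    ⟨ v , (λ x → degree x - totalDegree * indicator b x) ⟩
      ≡⟨ ⟨⟩-subʳ v degree (λ x → totalDegree * indicator b x) ⟩
    ⟨ v , degree ⟩ - ⟨ v , (λ x → totalDegree * indicator b x) ⟩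
      ≡⟨ cong (λ p → ⟨ v , degree ⟩ - p) (trans (∑-cong λ x → move (v x) totalDegree (indicator b x))
           (trans (∑-*ˡ totalDegree (λ x → indicator b x * v x)) (cong (totalDegree *_) (∑-indicator b v)))) ⟩
    ⟨ v , degree ⟩ - totalDegree * v b ∎
    where
    open ≡-Reasoning
    pad : ∀ p → p ≡ p - 0ℚ
    pad = solve-∀ ring
    move : ∀ p q r → p * (q * r) ≡ q * (r * p)
    move = solve-∀ ring

  module Potential (f : Fin n → ℚ) (fb≡0 : f b ≡ 0ℚ)
    (lap-f : ∀ x → lap f x ≡ degree x - totalDegree * indicator b x) where

    f-step : ∀ x → f x ≡ outside x + step f x
    f-step x with x Fin.≟ b
    ... | yes refl = trans fb≡0 (sym (trans (+-identityˡ _) (*-zeroˡ (∑ (λ y → transition G x y * f y)))))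
    ... | no x≢b = begin
      f x
        ≡⟨ *-identityˡ (f x) ⟨
      1ℚ * f x
        ≡⟨ cong (_* f x) (≢⇒reciprocal-inverse x≢b) ⟨
      ρ * degree x * f x
        ≡⟨ regroup ρ (degree x) (f x) (adjacency f x) ⟩
      ρ * (degree x * f x - adjacency f x) + 1ℚ * (ρ * adjacency f x)
        ≡⟨ cong (λ p → ρ * p + 1ℚ * (ρ * adjacency f x)) (trans (sym (lap-adjacency f x)) lap≡degree) ⟩
      ρ * degree x + 1ℚ * (ρ * adjacency f x)
        ≡⟨ cong₂ (λ p q → p + 1ℚ * q) (≢⇒reciprocal-inverse x≢b) (sym (∑-transition x f)) ⟩
      1ℚ + 1ℚ * ∑ (λ y → transition G x y * f y) ∎
      where
      open ≡-Reasoning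
      ρ = reciprocal (deg G x)
      regroup : ∀ ρ d p q → ρ * d * p ≡ ρ * (d * p - q) + 1ℚ * (ρ * q)
      regroup = solve-∀ ring
      trivial : ∀ p q → p - q * 0ℚ ≡ p
      trivial = solve-∀ ring
      lap≡degree : lap f x ≡ degree x
      lap≡degree = trans (lap-f x) (trans (cong (λ p → degree x - totalDegree * p) (indicator-≢ x≢b))
                                          (trivial (degree x) totalDegree))

    -- A bound for |f| at every vertex; summing spares taking a maximum.
    C : ℚ
    C = ∑ (λ x → ∣ f x ∣)

    0≤C : 0ℚ ≤ C
    0≤C = ∑-nonNeg λ x → 0≤∣p∣ (f x)

    remainder : ℕ → Fin n → ℚ
    remainder N x = f x - partialSum (λ k → survival k x) N

    partialSum-survival : ∀ N x →
      partialSum (λ k → survival k x) (suc N) ≡ outside x + step (λ y → partialSum (λ k → survival k y) N) x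
    partialSum-survival zero x = trans (+-comm 0ℚ (outside x)) (cong (outside x +_) (sym
      (trans (cong (outside x *_) (∑-≗0 λ y → *-zeroʳ (transition G x y))) (*-zeroʳ (outside x)))))
    partialSum-survival (suc N) x = begin
      partialSum s[ x ] (suc N) + survival (suc N) x
        ≡⟨ cong (_+ survival (suc N) x) (partialSum-survival N x) ⟩
      outside x + step (λ y → partialSum s[ y ] N) x + step (survival N) x
        ≡⟨ regroup (outside x) (step (λ y → partialSum s[ y ] N) x) (step (survival N) x) ⟩
      outside x + (1ℚ * step (λ y → partialSum s[ y ] N) x + 1ℚ * step (survival N) x)
        ≡⟨ cong (outside x +_) (step-linear 1ℚ 1ℚ (λ y → partialSum s[ y ] N) (survival N) x) ⟨
      outside x + step (λ y → 1ℚ * partialSum s[ y ] N + 1ℚ * survival N y) x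
        ≡⟨ cong (outside x +_) (step-cong (λ y → cong₂ _+_ (*-identityˡ (partialSum s[ y ] N)) (*-identityˡ (survival N y))) x) ⟩
      outside x + step (λ y → partialSum s[ y ] (suc N)) x ∎
      where
      open ≡-Reasoning
      s[_] : Fin n → ℕ → ℚ
      s[ x ] k = survival k x
      regroup : ∀ o p q → o + p + q ≡ o + (1ℚ * p + 1ℚ * q)
      regroup = solve-∀ ring

    -- f and the partial sums satisfy the same affine recursion with inhomogeneous term `outside`,
    -- which cancels in the difference.
    remainder-suc : ∀ N x → remainder (suc N) x ≡ step (remainder N) x
    remainder-suc N x = begin
      f x - partialSum (λ k → survival k x) (suc N)
        ≡⟨ cong₂ _-_ (f-step x) (partialSum-survival N x) ⟩
      outside x + step f x - (outside x + step (λ y → partialSum (λ k → survival k y) N) x)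
        ≡⟨ cancel (outside x) (step f x) _ ⟩
      step f x - step (λ y → partialSum (λ k → survival k y) N) x
        ≡⟨ step-sub f (λ y → partialSum (λ k → survival k y) N) x ⟨
      step (remainder N) x ∎
      where
      open ≡-Reasoning
      cancel : ∀ o p q → o + p - (o + q) ≡ p - q
      cancel = solve-∀ ring

    -- Stated for a general g so as to serve f and - f alike. At b the right side vanishes, which is
    -- where the normalisation f b = 0 enters.
    f≤C*outside : ∀ {g : Fin n → ℚ} → g b ≡ 0ℚ → (∀ x → g x ≤ ∣ f x ∣) → ∀ x → g x ≤ C * outside x
    f≤C*outside {g} gb≡0 g≤∣f∣ x with x Fin.≟ b
    ... | yes refl = ≤-reflexive (trans gb≡0 (sym (*-zeroʳ C)))
    ... | no  _    = subst (g x ≤_) (sym (*-identityʳ C))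
                       (≤-trans (g≤∣f∣ x) (term≤∑ (λ y → 0≤∣p∣ (f y)) x))

    -- `step` is linear and monotone, so the bound of f by C `outside` is carried along when both
    -- sides are iterated: they become the remainder and C times the survival probability.
    remainder≤ : ∀ N x → remainder N x ≤ C * survival N x
    remainder≤ zero    = f≤C*outside (trans (+-identityʳ (f b)) fb≡0)
                           (λ x → subst (_≤ ∣ f x ∣) (sym (+-identityʳ (f x))) (p≤∣p∣ (f x)))
    remainder≤ (suc N) x = subst₂ _≤_ (sym (remainder-suc N x)) (step-scale C (survival N) x)
                             (step-mono (remainder≤ N) x)

    -remainder≤ : ∀ N x → - remainder N x ≤ C * survival N x
    -remainder≤ zero    = f≤C*outside (cong -_ (trans (+-identityʳ (f b)) fb≡0))
                            (λ x → subst (λ p → - p ≤ ∣ f x ∣) (sym (+-identityʳ (f x))) (-p≤∣p∣ (f x)))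
    -remainder≤ (suc N) x = subst₂ _≤_ (trans (step-neg (remainder N) x) (cong -_ (sym (remainder-suc N x))))
                              (step-scale C (survival N) x) (step-mono (-remainder≤ N) x)

    module _ (a : Fin n) where
      private
        module D = Decay (λ k → survival k a) (f a) C (λ k → survival-nonNeg k a)
          (λ k → survival-antitone k a) (outside≤1 a) 0≤C (λ N → remainder≤ N a) (λ N → -remainder≤ N a)

      isExpectedHittingTime : IsExpectedHittingTime G a b (f a)
      isExpectedHittingTime =
          D.total-probability (hittingProb G a b) (hittingProb-zero-survival a) (λ j → hittingProb-suc-survival j a)
        , D.expectation (hittingProb G a b) (hittingProb-zero-survival a) (λ j → hittingProb-suc-survival j a)

      -- With probability at least P(a , c) the walk needs more than one step.
      1<potential : ∀ {c} → Adj G a c → a ≢ b → c ≢ b → 1ℚ < f a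
      1<potential {c} adj a≢b c≢b = <-≤-trans 1<S₂ (D.S≤f 2)
        where
        term = λ y → transition G a y * outside y
        0<ρ : 0ℚ < reciprocal (deg G a)
        0<ρ with deg G a | adj⇒reciprocal-inverse adj
        ... | zero  | eq = contradiction (trans (sym (*-zeroˡ (degree a))) eq) λ ()
        ... | suc m | _  = positive⁻¹ (reciprocal (suc m)) {{normalize-pos 1 (suc m)}}
        0<term : 0ℚ < term c
        0<term = subst (0ℚ <_) (sym (trans (cong₂ _*_ (trans (transition≡ a c)
          (trans (cong (reciprocal (deg G a) *_) (⟦⟧-true (Graph.adj? G a c) adj)) (*-identityʳ (reciprocal (deg G a)))))
          (outside-≢ c≢b)) (*-identityʳ (reciprocal (deg G a))))) 0<ρ
        0<s₁ : 0ℚ < survival 1 a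
        0<s₁ = subst (0ℚ <_) (sym (trans (cong (_* ∑ term) (outside-≢ a≢b)) (*-identityˡ (∑ term))))
          (<-≤-trans 0<term (term≤∑ {f = term} (λ y → *-nonNeg (transition-nonNeg a y) (outside-nonNeg y)) c))
        1<S₂ : 1ℚ < 0ℚ + survival 0 a + survival 1 a
        1<S₂ = subst₂ _<_ (+-identityʳ 1ℚ) (cong (_+ survival 1 a) (sym (trans (+-identityˡ _) (outside-≢ a≢b))))
          (+-monoʳ-< 1ℚ 0<s₁)

-- Degree sums and the hitting-time formula shared by G and G′.

⟦⟧-⊎ : {P Q : Set} (p? : Dec P) (q? : Dec Q) → ¬ (P × Q) → ⟦ p? ⊎-dec q? ⟧ ≡ ⟦ p? ⟧ + ⟦ q? ⟧
⟦⟧-⊎ (yes p) (yes q) ¬both = contradiction (p , q) ¬both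
⟦⟧-⊎ (yes p) (no ¬q) ¬both = refl
⟦⟧-⊎ (no ¬p) (yes q) ¬both = refl
⟦⟧-⊎ (no ¬p) (no ¬q) ¬both = refl

indicator-absorb : ∀ {n} (a x : Fin n) (φ : Fin n → ℚ) → indicator a x * φ x ≡ indicator a x * φ a
indicator-absorb a x φ with x Fin.≟ a
... | yes refl = refl
... | no  _    = trans (*-zeroˡ (φ x)) (sym (*-zeroˡ (φ a)))

module EdgeCount {n} (G : Graph n) where
  open Network G

  -- Exchanging the two vertices turns the count of pairs with x < y into that with y < x; together
  -- they cover each ordered adjacent pair once, the diagonal being empty.
  handshake : totalDegree ≡ fromℕ (edgeCount G) + fromℕ (edgeCount G)
  handshake = sym (begin
    fromℕ (edgeCount G) + fromℕ (edgeCount G)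
      ≡⟨ cong₂ _+_ edges≡ (trans edges≡ (∑∑-weight-sym below)) ⟩
    ∑ (λ x → ∑ (λ y → weight x y * below x y)) + ∑ (λ x → ∑ (λ y → weight x y * below y x))
      ≡⟨ ∑-distrib-+ (λ x → ∑ (λ y → weight x y * below x y)) (λ x → ∑ (λ y → weight x y * below y x)) ⟨
    ∑ (λ x → ∑ (λ y → weight x y * below x y) + ∑ (λ y → weight x y * below y x))
      ≡⟨ ∑-cong (λ x → trans (sym (∑-distrib-+ (λ y → weight x y * below x y) (λ y → weight x y * below y x)))
                             (∑-cong (one-orientation x))) ⟩
    totalDegree ∎)
    where
    open ≡-Reasoning
    below : Fin n → Fin n → ℚ
    below x y = ⟦ x Fin.<? y ⟧
    edges≡ : fromℕ (edgeCount G) ≡ ∑ (λ x → ∑ (λ y → weight x y * below x y))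
    edges≡ = begin
      fromℕ (edgeCount G)
        ≡⟨ fromℕ-count (λ (x , y) → (x Fin.<? y) ×-dec Graph.adj? G x y) (cartesianProductWith _,_ (allFin n) (allFin n)) ⟩
      sumOver (cartesianProductWith _,_ (allFin n) (allFin n)) (λ (x , y) → ⟦ (x Fin.<? y) ×-dec Graph.adj? G x y ⟧)
        ≡⟨ sumOver-cartesianProductWith _,_ (allFin n) (allFin n) _ ⟩
      sumOver (allFin n) (λ x → sumOver (allFin n) (λ y → ⟦ (x Fin.<? y) ×-dec Graph.adj? G x y ⟧))
        ≡⟨ sumOver-allFin {n} _ ⟩
      ∑ (λ x → sumOver (allFin n) (λ y → ⟦ (x Fin.<? y) ×-dec Graph.adj? G x y ⟧))
        ≡⟨ ∑-cong (λ x → trans (sumOver-allFin {n} _) (∑-cong λ y →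
             trans (⟦⟧-× (x Fin.<? y) (Graph.adj? G x y)) (*-comm (below x y) (weight x y)))) ⟩
      ∑ (λ x → ∑ (λ y → weight x y * below x y)) ∎
    one-orientation : ∀ x y → weight x y * below x y + weight x y * below y x ≡ weight x y
    one-orientation x y with Fin.<-cmp x y
    ... | tri< x<y _ y≮x = trans
      (cong₂ (λ p q → weight x y * p + weight x y * q) (⟦⟧-true (x Fin.<? y) x<y) (⟦⟧-false (y Fin.<? x) y≮x))
      (eq (weight x y))
      where
      eq : ∀ p → p * 1ℚ + p * 0ℚ ≡ p
      eq = solve-∀ ring
    ... | tri> x≮y _ y<x = trans
      (cong₂ (λ p q → weight x y * p + weight x y * q) (⟦⟧-false (x Fin.<? y) x≮y) (⟦⟧-true (y Fin.<? x) y<x))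
      (eq (weight x y))
      where
      eq : ∀ p → p * 0ℚ + p * 1ℚ ≡ p
      eq = solve-∀ ring
    ... | tri≈ _ refl _ = trans
      (cong (λ w → w * below x x + w * below x x) (weight-irrefl x))
      (trans (eq (below x x)) (sym (weight-irrefl x)))
      where
      eq : ∀ p → 0ℚ * p + 0ℚ * p ≡ 0ℚ
      eq = solve-∀ ring

symmetric-hitting-time : ∀ {n} (G : Graph n) → Connected G → let open Network G in
  ∀ {a b} → a ≢ b → ∀ {v} → lap v ≗ source-sink a b → ⟨ v , degree ⟩ ≡ 0ℚ → v a + v b ≡ 0ℚ →
  ∀ {m} → totalDegree ≡ m + m →
  IsExpectedHittingTime G a b (m * (v a - v b)) × (∀ {c} → Adj G a c → c ≢ b → 1ℚ < m * (v a - v b))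
symmetric-hitting-time G connected {a} {b} a≢b {v} lap-v v⊥degree centred {m} 2m =
  let f , fb≡0 , lap-f = hitting-potential
      open Potential f fb≡0 lap-f
      fa≡ : f a ≡ m * (v a - v b)
      fa≡ = begin
        f a                                    ≡⟨ potential-pairing {v = v} fb≡0 lap-f lap-v ⟩
        ⟨ v , degree ⟩ - totalDegree * v b     ≡⟨ cong₂ (λ p D → p - D * v b) v⊥degree 2m ⟩
        0ℚ - (m + m) * v b                     ≡⟨ eq m (v a) (v b) ⟩
        m * (v a - v b) - m * (v a + v b)      ≡⟨ cong (λ p → m * (v a - v b) - m * p) centred ⟩
        m * (v a - v b) - m * 0ℚ               ≡⟨ eq′ (m * (v a - v b)) m ⟩
        m * (v a - v b)                        ∎
  in subst (IsExpectedHittingTime G a b) fa≡ (isExpectedHittingTime a)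
   , λ adj c≢b → subst (1ℚ <_) fa≡ (1<potential a adj a≢b c≢b)
  where
  open Network G
  open HittingTime G connected b
  open ≡-Reasoning
  eq : ∀ m p q → 0ℚ - (m + m) * q ≡ m * (p - q) - m * (p + q)
  eq = solve-∀ ring
  eq′ : ∀ p m → p - m * 0ℚ ≡ p
  eq′ = solve-∀ ring

-- How weights, degrees, Laplacian and voltage change when an edge is deleted.

module EdgeDeletion {n} (G : Graph n) {a b : Fin n} (adj : Adj G a b) where
  private
    module N = Network G
    module N′ = Network (deleteEdge G a b)

  a≢b : a ≢ b
  a≢b a≡b = Graph.irrefl G a≡b adj

  -- The matrix e_a e_bᵀ + e_b e_aᵀ, by which the adjacency matrix decreases.
  deleted : Fin n → Fin n → ℚ
  deleted x y = indicator a x * indicator b y + indicator b x * indicator a y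

  deleted≡ : ∀ x y → ⟦ sameEdge? a b x y ⟧ ≡ deleted x y
  deleted≡ x y = trans
    (⟦⟧-⊎ (x Fin.≟ a ×-dec y Fin.≟ b) (x Fin.≟ b ×-dec y Fin.≟ a)
      (λ ((x≡a , _) , (x≡b , _)) → a≢b (trans (sym x≡a) x≡b)))
    (cong₂ _+_ (product a b) (product b a))
    where
    product : ∀ c d → ⟦ x Fin.≟ c ×-dec y Fin.≟ d ⟧ ≡ indicator c x * indicator d y
    product c d = trans (⟦⟧-× (x Fin.≟ c) (y Fin.≟ d))
      (sym (cong₂ _*_ (indicator≡⟦⟧ c x) (indicator≡⟦⟧ d y)))

  weight-deleteEdge : ∀ x y → N′.weight x y ≡ N.weight x y - deleted x y
  weight-deleteEdge x y = begin
    N′.weight x y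
      ≡⟨ ⟦⟧-× (Graph.adj? G x y) (¬? (sameEdge? a b x y)) ⟩
    N.weight x y * ⟦ ¬? (sameEdge? a b x y) ⟧
      ≡⟨ cong (N.weight x y *_) (⟦⟧-¬ (sameEdge? a b x y)) ⟩
    N.weight x y * (1ℚ - ⟦ sameEdge? a b x y ⟧)
      ≡⟨ present (sameEdge? a b x y) ⟩
    N.weight x y - ⟦ sameEdge? a b x y ⟧
      ≡⟨ cong (λ p → N.weight x y - p) (deleted≡ x y) ⟩
    N.weight x y - deleted x y ∎
    where
    open ≡-Reasoning
    same⇒adj : SameEdge a b x y → Adj G x y
    same⇒adj (inj₁ (refl , refl)) = adj
    same⇒adj (inj₂ (refl , refl)) = Graph.sym G adj
    -- On the deleted pair the old weight is 1, because a and b are adjacent; this makes the product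
    -- a difference.
    present : (same? : Dec (SameEdge a b x y)) → N.weight x y * (1ℚ - ⟦ same? ⟧) ≡ N.weight x y - ⟦ same? ⟧
    present (yes same) = trans (*-zeroʳ (N.weight x y)) (sym (cong (_- 1ℚ) (⟦⟧-true (Graph.adj? G x y) (same⇒adj same))))
    present (no _)     = trans (*-identityʳ (N.weight x y)) (sym (+-identityʳ (N.weight x y)))

  ∑-deleted : ∀ x (φ : Fin n → ℚ) → ∑ (λ y → deleted x y * φ y) ≡ indicator a x * φ b + indicator b x * φ a
  ∑-deleted x φ = begin
    ∑ (λ y → deleted x y * φ y)
      ≡⟨ ∑-cong (λ y → expand (indicator a x) (indicator b x) (indicator a y) (indicator b y) (φ y)) ⟩
    ∑ (λ y → indicator a x * (indicator b y * φ y) + indicator b x * (indicator a y * φ y))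
      ≡⟨ ∑-linear (indicator a x) (indicator b x) (λ y → indicator b y * φ y) (λ y → indicator a y * φ y) ⟩
    indicator a x * ⟨ indicator b , φ ⟩ + indicator b x * ⟨ indicator a , φ ⟩
      ≡⟨ cong₂ (λ p q → indicator a x * p + indicator b x * q) (∑-indicator b φ) (∑-indicator a φ) ⟩
    indicator a x * φ b + indicator b x * φ a ∎
    where
    open ≡-Reasoning
    expand : ∀ p q r s t → (p * s + q * r) * t ≡ p * (s * t) + q * (r * t)
    expand = solve-∀ ring

  -- With φ = 1 this yields the new degrees; with y ↦ φ x - φ y, which may depend on x, the new
  -- Laplacian.
  ∑-weight-deleteEdge : ∀ x (φ : Fin n → ℚ) →
    ∑ (λ y → N′.weight x y * φ y)
    ≡ ∑ (λ y → N.weight x y * φ y) - (indicator a x * φ b + indicator b x * φ a)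
  ∑-weight-deleteEdge x φ = begin
    ∑ (λ y → N′.weight x y * φ y)
      ≡⟨ ∑-cong (λ y → trans (cong (_* φ y) (weight-deleteEdge x y)) (expand (N.weight x y) (deleted x y) (φ y))) ⟩
    ∑ (λ y → N.weight x y * φ y - deleted x y * φ y)
      ≡⟨ ∑-distrib-- (λ y → N.weight x y * φ y) (λ y → deleted x y * φ y) ⟩
    ∑ (λ y → N.weight x y * φ y) - ∑ (λ y → deleted x y * φ y)
      ≡⟨ cong (λ p → ∑ (λ y → N.weight x y * φ y) - p) (∑-deleted x φ) ⟩
    ∑ (λ y → N.weight x y * φ y) - (indicator a x * φ b + indicator b x * φ a) ∎
    where
    open ≡-Reasoning
    expand : ∀ p q r → (p - q) * r ≡ p * r - q * r
    expand = solve-∀ ring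

  degree-deleteEdge : ∀ x → N′.degree x ≡ N.degree x - (indicator a x + indicator b x)
  degree-deleteEdge x = begin
    N′.degree x                                  ≡⟨ ∑-cong (λ y → *-identityʳ (N′.weight x y)) ⟨
    ∑ (λ y → N′.weight x y * 1ℚ)                 ≡⟨ ∑-weight-deleteEdge x (const 1ℚ) ⟩
    ∑ (λ y → N.weight x y * 1ℚ) - (indicator a x * 1ℚ + indicator b x * 1ℚ)
      ≡⟨ cong₂ _-_ (∑-cong λ y → *-identityʳ (N.weight x y))
                   (cong₂ _+_ (*-identityʳ (indicator a x)) (*-identityʳ (indicator b x))) ⟩
    N.degree x - (indicator a x + indicator b x) ∎
    where open ≡-Reasoning

  lap-deleteEdge : ∀ (φ : Fin n → ℚ) x → N′.lap φ x ≡ N.lap φ x - (φ a - φ b) * source-sink a b x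
  lap-deleteEdge φ x = begin
    N′.lap φ x
      ≡⟨ ∑-weight-deleteEdge x (λ y → φ x - φ y) ⟩
    N.lap φ x - (indicator a x * (φ x - φ b) + indicator b x * (φ x - φ a))
      ≡⟨ cong (λ p → N.lap φ x - p) (cong₂ _+_ (indicator-absorb a x (λ z → φ z - φ b)) (indicator-absorb b x (λ z → φ z - φ a))) ⟩
    N.lap φ x - (indicator a x * (φ a - φ b) + indicator b x * (φ b - φ a))
      ≡⟨ regroup (N.lap φ x) (indicator a x) (indicator b x) (φ a) (φ b) ⟩
    N.lap φ x - (φ a - φ b) * source-sink a b x ∎
    where
    open ≡-Reasoning
    regroup : ∀ l p q r s → l - (p * (r - s) + q * (s - r)) ≡ l - (r - s) * (p - q)
    regroup = solve-∀ ring

  totalDegree-deleteEdge : N′.totalDegree ≡ N.totalDegree - (1ℚ + 1ℚ)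
  totalDegree-deleteEdge = begin
    N′.totalDegree
      ≡⟨ ∑-cong degree-deleteEdge ⟩
    ∑ (λ x → N.degree x - (indicator a x + indicator b x))
      ≡⟨ ∑-distrib-- N.degree (λ x → indicator a x + indicator b x) ⟩
    N.totalDegree - ∑ (λ x → indicator a x + indicator b x)
      ≡⟨ cong (λ p → N.totalDegree - p) (trans (∑-distrib-+ (indicator a) (indicator b))
           (cong₂ _+_ (∑-indicator≡1 a) (∑-indicator≡1 b))) ⟩
    N.totalDegree - (1ℚ + 1ℚ) ∎
    where open ≡-Reasoning

  ⟨degree-deleteEdge⟩ : ∀ (φ : Fin n → ℚ) → ⟨ φ , N′.degree ⟩ ≡ ⟨ φ , N.degree ⟩ - (φ a + φ b)
  ⟨degree-deleteEdge⟩ φ = begin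
    ⟨ φ , N′.degree ⟩
      ≡⟨ ⟨⟩-congʳ φ degree-deleteEdge ⟩
    ⟨ φ , (λ x → N.degree x - (indicator a x + indicator b x)) ⟩
      ≡⟨ ⟨⟩-subʳ φ N.degree (λ x → indicator a x + indicator b x) ⟩
    ⟨ φ , N.degree ⟩ - ⟨ φ , (λ x → indicator a x + indicator b x) ⟩
      ≡⟨ cong (λ p → ⟨ φ , N.degree ⟩ - p) (trans
           (∑-cong λ x → expand (φ x) (indicator a x) (indicator b x))
           (trans (∑-distrib-+ (λ x → indicator a x * φ x) (λ x → indicator b x * φ x))
                  (cong₂ _+_ (∑-indicator a φ) (∑-indicator b φ)))) ⟩
    ⟨ φ , N.degree ⟩ - (φ a + φ b) ∎
    where
    open ≡-Reasoning
    expand : ∀ p q r → p * (q + r) ≡ q * p + r * p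
    expand = solve-∀ ring

  lap-deleteEdge-voltage : ∀ {v : Fin n → ℚ} → N.lap v ≗ source-sink a b →
    ∀ x → N′.lap v x ≡ (1ℚ - (v a - v b)) * source-sink a b x
  lap-deleteEdge-voltage {v} lap-v x = begin
    N′.lap v x                                           ≡⟨ lap-deleteEdge v x ⟩
    N.lap v x - (v a - v b) * source-sink a b x
      ≡⟨ cong (_- (v a - v b) * source-sink a b x) (lap-v x) ⟩
    source-sink a b x - (v a - v b) * source-sink a b x  ≡⟨ factor (v a - v b) (source-sink a b x) ⟩
    (1ℚ - (v a - v b)) * source-sink a b x               ∎
    where
    open ≡-Reasoning
    factor : ∀ r p → p - r * p ≡ (1ℚ - r) * p
    factor = solve-∀ ring

  module _ (connected′ : Connected (deleteEdge G a b)) {v : Fin n → ℚ} (lap-v : N.lap v ≗ source-sink a b) where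
    private
      R : ℚ
      R = v a - v b

    -- If R = 1, the rank-one change annihilates v: its Laplacian on G′ is zero, so v is constant on
    -- the connected G′ and R = 0, a contradiction.
    1-R≢0 : 1ℚ - R ≢ 0ℚ
    1-R≢0 1-R≡0 = contradiction (trans (sym (trans (cong (λ p → 1ℚ - p) R≡0) (+-identityʳ 1ℚ))) 1-R≡0) λ ()
      where
      R≡0 : R ≡ 0ℚ
      R≡0 = trans (cong (_- v b) (N′.lap≡0⇒constant connected′ v (λ x → trans (lap-deleteEdge-voltage {v} lap-v x)
              (trans (cong (_* source-sink a b x) 1-R≡0) (*-zeroˡ (source-sink a b x)))) a b)) (+-inverseʳ (v b))

    private
      instance
        1-R-nonZero : NonZero (1ℚ - R)
        1-R-nonZero = ≢-nonZero 1-R≢0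

    voltage′ : Fin n → ℚ
    voltage′ x = 1/ (1ℚ - R) * v x

    lap-voltage′ : N′.lap voltage′ ≗ source-sink a b
    lap-voltage′ x = begin
      N′.lap voltage′ x                                   ≡⟨ IsLinear.scale N′.lap-linear (1/ (1ℚ - R)) v x ⟩
      1/ (1ℚ - R) * N′.lap v x
        ≡⟨ cong (1/ (1ℚ - R) *_) (lap-deleteEdge-voltage {v} lap-v x) ⟩
      1/ (1ℚ - R) * ((1ℚ - R) * source-sink a b x)
        ≡⟨ *-assoc (1/ (1ℚ - R)) (1ℚ - R) (source-sink a b x) ⟨
      1/ (1ℚ - R) * (1ℚ - R) * source-sink a b x          ≡⟨ cong (_* source-sink a b x) (*-inverseˡ (1ℚ - R)) ⟩
      1ℚ * source-sink a b x                              ≡⟨ *-identityˡ (source-sink a b x) ⟩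
      source-sink a b x                                   ∎
      where open ≡-Reasoning

    voltage′-difference : voltage′ a - voltage′ b ≡ R * 1/ (1ℚ - R)
    voltage′-difference = factor (1/ (1ℚ - R)) (v a) (v b)
      where
      factor : ∀ c p q → c * p - c * q ≡ (p - q) * c
      factor = solve-∀ ring

    -- R / (1 - R) is a unit-voltage difference on G′, hence positive; with 1 - R ≤ 0 its product
    -- with 1 - R, which is R, would be nonpositive.
    1-R-pos : 0ℚ < R → 0ℚ < 1ℚ - R
    1-R-pos 0<R = ≰⇒> λ 1-R≤0 → <-irrefl refl (<-≤-trans 0<R (begin
      R                              ≡⟨ *-identityʳ R ⟨
      R * 1ℚ                         ≡⟨ cong (R *_) (*-inverseˡ (1ℚ - R)) ⟨
      R * (1/ (1ℚ - R) * (1ℚ - R))   ≡⟨ *-assoc R (1/ (1ℚ - R)) (1ℚ - R) ⟨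
      R * 1/ (1ℚ - R) * (1ℚ - R)     ≤⟨ *-monoˡ-≤ (R * 1/ (1ℚ - R)) (<⇒≤ 0<R′) 1-R≤0 ⟩
      R * 1/ (1ℚ - R) * 0ℚ           ≡⟨ *-zeroʳ (R * 1/ (1ℚ - R)) ⟩
      0ℚ                             ∎))
      where
      open ≤-Reasoning
      0<R′ : 0ℚ < R * 1/ (1ℚ - R)
      0<R′ = subst (0ℚ <_) voltage′-difference
               (Poisson.voltage-difference-pos (deleteEdge G a b) connected′ {v = voltage′} a≢b lap-voltage′)

    pairing-voltage′ : ⟨ voltage′ , N′.degree ⟩ ≡ 1/ (1ℚ - R) * (⟨ v , N.degree ⟩ - (v a + v b))
    pairing-voltage′ = begin
      ⟨ voltage′ , N′.degree ⟩
        ≡⟨ ⟨degree-deleteEdge⟩ voltage′ ⟩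
      ⟨ voltage′ , N.degree ⟩ - (voltage′ a + voltage′ b)
        ≡⟨ cong (_- (voltage′ a + voltage′ b)) (trans
             (∑-cong λ x → *-assoc (1/ (1ℚ - R)) (v x) (N.degree x))
             (∑-*ˡ (1/ (1ℚ - R)) (λ x → v x * N.degree x))) ⟩
      1/ (1ℚ - R) * ⟨ v , N.degree ⟩ - (voltage′ a + voltage′ b)
        ≡⟨ factor (1/ (1ℚ - R)) ⟨ v , N.degree ⟩ (v a) (v b) ⟩
      1/ (1ℚ - R) * (⟨ v , N.degree ⟩ - (v a + v b)) ∎
      where
      open ≡-Reasoning
      factor : ∀ c p q r → c * p - (c * q + c * r) ≡ c * (p - (q + r))
      factor = solve-∀ ring

-- Both hitting times from one balanced voltage, and their comparison.

module BalancedVoltage {n} (G : Graph n) (connected : Connected G) {a b : Fin n} (adj : Adj G a b)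
  (connected′ : Connected (deleteEdge G a b)) (regular : ∀ x → Network.degree G x ≡ Network.degree G a)
  (v : Fin n → ℚ) (lap-v : Network.lap G v ≗ source-sink a b) (∑v≡0 : MeanZero v) (centred : v a + v b ≡ 0ℚ) where
  open Network G
  open EdgeDeletion G adj
  private module N′ = Network (deleteEdge G a b)

  m : ℚ
  m = fromℕ (edgeCount G)

  R : ℚ
  R = v a - v b

  v′ : Fin n → ℚ
  v′ = voltage′ connected′ {v} lap-v

  instance
    nz : NonZero (1ℚ - R)
    nz = ≢-nonZero (1-R≢0 connected′ {v} lap-v)

  h′ : ℚ
  h′ = ((m - 1ℚ) * R) ÷ (1ℚ - R)

  expand : ∀ m r → (m - 1ℚ) * r ≡ m * r - r
  expand = solve-∀ ring

  v⊥degree : ⟨ v , degree ⟩ ≡ 0ℚ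
  v⊥degree = begin
    ⟨ v , degree ⟩                ≡⟨ ∑-cong (λ x → trans (*-comm (v x) (degree x))
                                       (cong (_* v x) (regular x))) ⟩
    ∑ (λ x → degree a * v x)      ≡⟨ ∑-*ˡ (degree a) v ⟩
    degree a * ∑ v                ≡⟨ cong (degree a *_) ∑v≡0 ⟩
    degree a * 0ℚ                 ≡⟨ *-zeroʳ (degree a) ⟩
    0ℚ                            ∎
    where open ≡-Reasoning

  hitting : IsExpectedHittingTime G a b (m * R) × (∀ {c} → Adj G a c → c ≢ b → 1ℚ < m * R)
  hitting = symmetric-hitting-time G connected a≢b {v} lap-v v⊥degree centred {m} (EdgeCount.handshake G)

  v′⊥degree : ⟨ v′ , N′.degree ⟩ ≡ 0ℚ
  v′⊥degree = trans (pairing-voltage′ connected′ {v} lap-v)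
    (trans (cong₂ (λ p q → 1/ (1ℚ - R) * (p - q)) v⊥degree centred) (*-zeroʳ (1/ (1ℚ - R))))

  centred′ : v′ a + v′ b ≡ 0ℚ
  centred′ = trans (sym (*-distribˡ-+ (1/ (1ℚ - R)) (v a) (v b)))
    (trans (cong (1/ (1ℚ - R) *_) centred) (*-zeroʳ (1/ (1ℚ - R))))

  -- The number of edges of G′ is read off from the degree sum, so `edgeCount` is evaluated for G
  -- alone.
  totalDegree′ : N′.totalDegree ≡ (m - 1ℚ) + (m - 1ℚ)
  totalDegree′ = trans totalDegree-deleteEdge
    (trans (cong (_- (1ℚ + 1ℚ)) (EdgeCount.handshake G)) (regroup m))
    where
    regroup : ∀ m → m + m - (1ℚ + 1ℚ) ≡ (m - 1ℚ) + (m - 1ℚ)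
    regroup = solve-∀ ring

  hitting′ : IsExpectedHittingTime (deleteEdge G a b) a b ((m - 1ℚ) * (v′ a - v′ b))
  hitting′ = proj₁ (symmetric-hitting-time (deleteEdge G a b) connected′ a≢b {v′}
    (lap-voltage′ connected′ {v} lap-v) v′⊥degree centred′ {m - 1ℚ} totalDegree′)

  h′≡ : (m - 1ℚ) * (v′ a - v′ b) ≡ h′
  h′≡ = trans (cong ((m - 1ℚ) *_) (voltage′-difference connected′ {v} lap-v))
              (sym (*-assoc (m - 1ℚ) R (1/ (1ℚ - R))))

  -- A path from a to b in G′ must start with an edge to some c other than b, since the edge to b
  -- was deleted; this c is a neighbour of a in G too.
  1<h : 1ℚ < m * R
  1<h with connected′ a b
  ... | Star.ε                 = contradiction refl a≢b
  ... | (adj-c , not-b) ◅ _ = proj₂ hitting adj-c (λ c≡b → not-b (inj₁ (refl , c≡b)))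

  0<R : 0ℚ < R
  0<R = Poisson.voltage-difference-pos G connected {v = v} a≢b lap-v

  -- Multiplied by 1 - R > 0, the difference of the two sides becomes R (m R - 1), a product of
  -- positive factors.
  h<h′ : m * R < h′
  h<h′ = *-cancelʳ-<-nonNeg (1ℚ - R) {{nonNegative (<⇒≤ (1-R-pos connected′ {v} lap-v 0<R))}}
    (0<q-p⇒p<q (subst (0ℚ <_) (begin
      R * (m * R - 1ℚ)                                     ≡⟨ regroup m R ⟩
      (m - 1ℚ) * R * 1ℚ - m * R * (1ℚ - R)
        ≡⟨ cong (λ p → (m - 1ℚ) * R * p - m * R * (1ℚ - R)) (*-inverseˡ (1ℚ - R)) ⟨
      (m - 1ℚ) * R * (1/ (1ℚ - R) * (1ℚ - R)) - m * R * (1ℚ - R)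
        ≡⟨ cong (_- m * R * (1ℚ - R)) (*-assoc ((m - 1ℚ) * R) (1/ (1ℚ - R)) (1ℚ - R)) ⟨
      h′ * (1ℚ - R) - m * R * (1ℚ - R)                     ∎)
      (*-pos 0<R (p<q⇒0<q-p 1<h))))
    where
    open ≡-Reasoning
    regroup : ∀ m r → r * (m * r - 1ℚ) ≡ (m - 1ℚ) * r * 1ℚ - m * r * (1ℚ - r)
    regroup = solve-∀ ring

theorem4 : ∀ {n : ℕ} (G : Graph n) → 3 ≤ⁿ n → Connected G → WalkRegular G →
    ∀ (a b : Fin n) → Adj G a b → Connected (deleteEdge G a b) →
    ∃[ R ] ∃[ h ] ∃[ h′ ]
    ( IsEffectiveResistance G a b R
    × IsExpectedHittingTime G a b h
    × IsExpectedHittingTime (deleteEdge G a b) a b h′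
    × h < h′
    × h ≡ fromℕ (edgeCount G) * R
    × Σ[ nz ∈ NonZero (1ℚ - R) ]
    ( h′ ≡ _÷_ ((fromℕ (edgeCount G) - 1ℚ) * R) (1ℚ - R) {{nz}}
    × h′ ≡ _÷_ (h - R) (1ℚ - R) {{nz}} ) )
theorem4 G _ connected walk-regular a b adj connected′ =
  let open WalkRegularity G connected walk-regular
      v , lap-v , ∑v≡0 , centred = balanced-voltage a b
      open BalancedVoltage G connected adj connected′ (λ x → regular x a) v lap-v ∑v≡0 centred
  in R , m * R , h′
   , Poisson.effective-resistance G connected {v = v} lap-v
   , proj₁ hitting
   , subst (IsExpectedHittingTime (deleteEdge G a b) a b) h′≡ hitting′
   , h<h′
   , refl
   , nz
   , refl
   , cong (_* 1/_ (1ℚ - R) {{nz}}) (expand m R)
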